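{- Up to first order interdefinability, the vector space $\mathbb{F}_2^\omega$ has exactly 4 first order definable reducts: (1) $\mathbb{F}_2^\omega$ itself, corresponding to the group $\operatorname{GL}(\omega,2)$ (i.e. having this automorphism group); (2) the affine space, corresponding to $\operatorname{AGL}$; (3) the structure with one unary relation $\{0\}$, corresponding to $\operatorname{Sym}_0(\mathbb{F}_2^\omega)$; (4) the trivial structure (with no relations), corresponding to $\operatorname{Sym}(\mathbb{F}_2^\omega)$.
   Context: $\mathbb{F}_2^\omega$ denotes the countably infinite dimensional vector space over the two element field, $\operatorname{GL}(\omega,2)$ its automorphism group, $\operatorname{Sym}(\mathbb{F}_2^\omega)$ the group of all permutations of its elements, and $\operatorname{Sym}_0(\mathbb{F}_2^\omega)$ the stabilizer of $0$ in it. $\operatorname{AGL}$ is the subgroup of $\operatorname{Sym}(\mathbb{F}_2^\omega)$ generated by $\operatorname{GL}(\omega,2)$ and all translations $v\mapsto v+a$; it is the automorphism group of the affine space obtained from $\mathbb{F}_2^\omega$, which can be viewed as the set $\mathbb{F}_2^\omega$ with the ternary addition $(a,b,c)\mapsto a+b+c$. A first order definable reduct of a structure is a relational structure on the same underlying set all of whose relations are first order definable (without parameters) in the original structure. Two structures on the same underlying set are first order interdefinable if each is a first order definable reduct of the other. Since $\mathbb{F}_2^\omega$ is $\omega$-categorical, taking automorphism groups gives a bijection between interdefinability classes of first order definable reducts and closed (in the pointwise convergence topology) subgroups of $\operatorname{Sym}(\mathbb{F}_2^\omega)$ containing $\operatorname{GL}(\omega,2)$. -}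

module Defs where

open import Level using (0ℓ)
open import Algebra.Bundles using (CommutativeRing; Ring)
open import Algebra.Module.Bundles using (LeftModule)
open import Algebra.Module.Morphism.Structures using (IsLeftModuleHomomorphism)
open import Data.Bool using (Bool; true; false; not; _xor_; _∧_)
open import Data.Bool.Properties using
  (not-¬; xor-∧-commutativeRing; xor-assoc; xor-comm; xor-same; xor-identityʳ)
open import Data.Empty using (⊥; ⊥-elim)
open import Data.Fin using (Fin; zero; suc)
open import Data.Nat using (ℕ; zero; suc; _≤_; z≤n; s≤s)
open import Data.Product using (∃-syntax; _×_; _,_; proj₁; proj₂)
open import Data.Sum using (_⊎_)
open import Data.Vec using (Vec; []; _∷_; lookup; map)
open import Function using (_∘_; _↔_; _⇔_; Inverse)
open import Function.Construct.Composition using (_↔-∘_)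
open import Function.Construct.Identity using (↔-id)
open import Function.Construct.Symmetry using (↔-sym)
open import Relation.Binary.PropositionalEquality
  using (_≡_; _≗_; refl; sym; trans; cong; cong₂; isEquivalence)
open import Relation.Unary using (Pred; _≐_; U; _∪_)

-- A nonzero finitely supported 0-1 sequence, cut off after its last 1:
-- `b₀ ∷ b₁ ∷ … ∷ [1]` is the sequence b₀, b₁, …, 1, 0, 0, 0, …
data NonzeroSeq : Set where
  [1] : NonzeroSeq
  _∷_ : Bool → NonzeroSeq → NonzeroSeq

-- Finitely supported sequences ℕ → 𝔽₂, in a normal form for which _≡_ is
-- equality of sequences (see coord-injective, coord-finite and
-- coord-surjective below).
data 𝔽₂^ω : Set where
  𝟎  : 𝔽₂^ω
  nz : NonzeroSeq → 𝔽₂^ω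

coord⁺ : NonzeroSeq → ℕ → Bool
coord⁺ [1]      zero    = true
coord⁺ [1]      (suc i) = false
coord⁺ (b ∷ v)  zero    = b
coord⁺ (b ∷ v)  (suc i) = coord⁺ v i

coord : 𝔽₂^ω → ℕ → Bool
coord 𝟎      i = false
coord (nz v) i = coord⁺ v i

-- Prepends a coordinate.
cons : Bool → 𝔽₂^ω → 𝔽₂^ω
cons false 𝟎      = 𝟎
cons true  𝟎      = nz [1]
cons b     (nz v) = nz (b ∷ v)

infixl 6 _⊕_ _⊕⁺_
infixr 7 _·_

_⊕⁺_ : NonzeroSeq → NonzeroSeq → 𝔽₂^ω
[1]     ⊕⁺ [1]     = 𝟎
[1]     ⊕⁺ (b ∷ w) = nz (not b ∷ w)
(a ∷ v) ⊕⁺ [1]     = nz (not a ∷ v)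
(a ∷ v) ⊕⁺ (b ∷ w) = cons (a xor b) (v ⊕⁺ w)

_⊕_ : 𝔽₂^ω → 𝔽₂^ω → 𝔽₂^ω
𝟎    ⊕ w    = w
nz v ⊕ 𝟎    = nz v
nz v ⊕ nz w = v ⊕⁺ w

_·_ : Bool → 𝔽₂^ω → 𝔽₂^ω
false · v = 𝟎
true  · v = v

coord-cons-zero : ∀ b v → coord (cons b v) zero ≡ b
coord-cons-zero false 𝟎      = refl
coord-cons-zero true  𝟎      = refl
coord-cons-zero false (nz v) = refl
coord-cons-zero true  (nz v) = refl

coord-cons-suc : ∀ b v i → coord (cons b v) (suc i) ≡ coord v i
coord-cons-suc false 𝟎      i = refl
coord-cons-suc true  𝟎      i = refl
coord-cons-suc false (nz v) i = refl
coord-cons-suc true  (nz v) i = refl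

coord⁺-nonzero : ∀ v → ∃[ i ] coord⁺ v i ≡ true
coord⁺-nonzero [1]     = zero , refl
coord⁺-nonzero (b ∷ v) = suc (proj₁ (coord⁺-nonzero v)) , proj₂ (coord⁺-nonzero v)

private
  absurd-zero : ∀ {A : Set} v → (∀ i → coord⁺ v i ≡ false) → A
  absurd-zero v h with coord⁺-nonzero v
  ... | i , p = ⊥-elim (not-¬ p (h i))

coord⁺-injective : ∀ v w → coord⁺ v ≗ coord⁺ w → v ≡ w
coord⁺-injective [1]     [1]     h = refl
coord⁺-injective [1]     (b ∷ w) h = absurd-zero w (λ i → sym (h (suc i)))
coord⁺-injective (a ∷ v) [1]     h = absurd-zero v (λ i → h (suc i))
coord⁺-injective (a ∷ v) (b ∷ w) h =
  cong₂ _∷_ (h zero) (coord⁺-injective v w (h ∘ suc))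

coord-injective : ∀ v w → coord v ≗ coord w → v ≡ w
coord-injective 𝟎      𝟎      h = refl
coord-injective 𝟎      (nz w) h = absurd-zero w (sym ∘ h)
coord-injective (nz v) 𝟎      h = absurd-zero v h
coord-injective (nz v) (nz w) h = cong nz (coord⁺-injective v w h)

coord-finite : ∀ v → ∃[ n ] (∀ i → n ≤ i → coord v i ≡ false)
coord-finite 𝟎      = 0 , λ _ _ → refl
coord-finite (nz v) = finite⁺ v
  where
  finite⁺ : ∀ v → ∃[ n ] (∀ i → n ≤ i → coord⁺ v i ≡ false)
  finite⁺ [1]     = 1 , λ { (suc i) _ → refl }
  finite⁺ (b ∷ v) = suc (proj₁ (finite⁺ v)) ,
    λ { (suc i) (s≤s n≤i) → proj₂ (finite⁺ v) i n≤i }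

coord-surjective : ∀ n (f : ℕ → Bool) → (∀ i → n ≤ i → f i ≡ false) →
                   ∃[ v ] coord v ≗ f
coord-surjective zero    f h = 𝟎 , λ i → sym (h i z≤n)
coord-surjective (suc n) f h
  with coord-surjective n (f ∘ suc) (λ i n≤i → h (suc i) (s≤s n≤i))
... | v , p = cons (f zero) v , λ
  { zero    → coord-cons-zero (f zero) v
  ; (suc i) → trans (coord-cons-suc (f zero) v i) (p i) }

coord-⊕⁺ : ∀ v w i → coord (v ⊕⁺ w) i ≡ coord⁺ v i xor coord⁺ w i
coord-⊕⁺ [1]         [1]         zero    = refl
coord-⊕⁺ [1]         [1]         (suc i) = refl
coord-⊕⁺ [1]         (b ∷ w)     zero    = refl
coord-⊕⁺ [1]         (b ∷ w)     (suc i) = refl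
coord-⊕⁺ (a ∷ v)     [1]         zero    = xor-comm true a
coord-⊕⁺ (a ∷ v)     [1]         (suc i) = sym (xor-identityʳ _)
coord-⊕⁺ (a ∷ v)     (b ∷ w)     zero    = coord-cons-zero (a xor b) (v ⊕⁺ w)
coord-⊕⁺ (a ∷ v)     (b ∷ w)     (suc i) =
  trans (coord-cons-suc (a xor b) (v ⊕⁺ w) i) (coord-⊕⁺ v w i)

coord-⊕ : ∀ v w i → coord (v ⊕ w) i ≡ coord v i xor coord w i
coord-⊕ 𝟎      w      i = refl
coord-⊕ (nz v) 𝟎      i = sym (xor-identityʳ _)
coord-⊕ (nz v) (nz w) i = coord-⊕⁺ v w i

⊕-identityʳ : ∀ v → v ⊕ 𝟎 ≡ v
⊕-identityʳ 𝟎      = refl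
⊕-identityʳ (nz v) = refl

⊕-comm : ∀ v w → v ⊕ w ≡ w ⊕ v
⊕-comm v w = coord-injective _ _ λ i →
  trans (coord-⊕ v w i)
  (trans (xor-comm (coord v i) (coord w i)) (sym (coord-⊕ w v i)))

⊕-assoc : ∀ u v w → (u ⊕ v) ⊕ w ≡ u ⊕ (v ⊕ w)
⊕-assoc u v w = coord-injective _ _ λ i →
  trans (coord-⊕ (u ⊕ v) w i)
  (trans (cong (_xor coord w i) (coord-⊕ u v i))
  (trans (xor-assoc (coord u i) (coord v i) (coord w i))
  (trans (cong (coord u i xor_) (sym (coord-⊕ v w i)))
  (sym (coord-⊕ u (v ⊕ w) i)))))

⊕-self : ∀ v → v ⊕ v ≡ 𝟎
⊕-self v = coord-injective _ _ λ i → trans (coord-⊕ v v i) (xor-same (coord v i))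

·-distribˡ : ∀ c v w → c · (v ⊕ w) ≡ c · v ⊕ c · w
·-distribˡ false v w = refl
·-distribˡ true  v w = refl

·-distribʳ : ∀ v c d → (c xor d) · v ≡ c · v ⊕ d · v
·-distribʳ v false d     = refl
·-distribʳ v true  false = sym (⊕-identityʳ v)
·-distribʳ v true  true  = sym (⊕-self v)

·-assoc : ∀ c d v → (c ∧ d) · v ≡ c · (d · v)
·-assoc false d v = refl
·-assoc true  d v = refl

·-zeroʳ : ∀ c → c · 𝟎 ≡ 𝟎
·-zeroʳ false = refl
·-zeroʳ true  = refl

𝔽₂ : Ring 0ℓ 0ℓ
𝔽₂ = CommutativeRing.ring xor-∧-commutativeRing

𝔽₂^ω-leftModule : LeftModule 𝔽₂ 0ℓ 0ℓ
𝔽₂^ω-leftModule = record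
  { Carrierᴹ = 𝔽₂^ω
  ; _≈ᴹ_ = _≡_
  ; _+ᴹ_ = _⊕_
  ; _*ₗ_ = _·_
  ; 0ᴹ   = 𝟎
  ; -ᴹ_  = λ v → v
  ; isLeftModule = record
    { isLeftSemimodule = record
      { +ᴹ-isCommutativeMonoid = record
        { isMonoid = record
          { isSemigroup = record
            { isMagma = record
              { isEquivalence = isEquivalence
              ; ∙-cong = cong₂ _⊕_ }
            ; assoc = ⊕-assoc }
          ; identity = (λ _ → refl) , ⊕-identityʳ }
        ; comm = ⊕-comm }
      ; isPreleftSemimodule = record
        { *ₗ-cong = cong₂ _·_
        ; *ₗ-zeroˡ = λ _ → refl
        ; *ₗ-distribʳ = ·-distribʳ
        ; *ₗ-identityˡ = λ _ → refl
        ; *ₗ-assoc = ·-assoc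
        ; *ₗ-zeroʳ = ·-zeroʳ
        ; *ₗ-distribˡ = ·-distribˡ } }
    ; -ᴹ‿cong = λ eq → eq
    ; -ᴹ‿inverse = ⊕-self , ⊕-self } }

record Signature : Set₁ where
  field
    Symbol : Set
    arity  : Symbol → ℕ

open Signature

record Structure (A : Set) : Set₁ where
  field
    signature : Signature
    rel       : (R : Symbol signature) → Pred (Vec A (arity signature R)) 0ℓ

open Structure

infix  5 _≈_
infixr 4 _∧′_
infixr 3 _∨′_
infixr 2 _⇒′_

-- First order formulas with equality whose free variables are among n
-- variables; quantifiers bind variable 0 and shift the others.
data Formula (𝓛 : Signature) (n : ℕ) : Set where
  atom            : (R : Symbol 𝓛) → Vec (Fin n) (arity 𝓛 R) → Formula 𝓛 n
  _≈_             : Fin n → Fin n → Formula 𝓛 n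
  ⊥′              : Formula 𝓛 n
  _∧′_ _∨′_ _⇒′_  : Formula 𝓛 n → Formula 𝓛 n → Formula 𝓛 n
  ∀′ ∃′           : Formula 𝓛 (suc n) → Formula 𝓛 n

module _ {A : Set} where

  infix 4 _⊨_[_]

  _⊨_[_] : (M : Structure A) → ∀ {n} → Formula (signature M) n → Vec A n → Set
  M ⊨ atom R xs [ ρ ] = rel M R (map (lookup ρ) xs)
  M ⊨ x ≈ y     [ ρ ] = lookup ρ x ≡ lookup ρ y
  M ⊨ ⊥′        [ ρ ] = ⊥
  M ⊨ φ ∧′ ψ    [ ρ ] = M ⊨ φ [ ρ ] × M ⊨ ψ [ ρ ]
  M ⊨ φ ∨′ ψ    [ ρ ] = M ⊨ φ [ ρ ] ⊎ M ⊨ ψ [ ρ ]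
  M ⊨ φ ⇒′ ψ    [ ρ ] = M ⊨ φ [ ρ ] → M ⊨ ψ [ ρ ]
  M ⊨ ∀′ φ      [ ρ ] = ∀ a → M ⊨ φ [ a ∷ ρ ]
  M ⊨ ∃′ φ      [ ρ ] = ∃[ a ] M ⊨ φ [ a ∷ ρ ]

  Definable : Structure A → ∀ {n} → Pred (Vec A n) 0ℓ → Set
  Definable M {n} P = ∃[ φ ] P ≐ (λ (ρ : Vec A n) → M ⊨ φ [ ρ ])

  infix 4 _IsReductOf_

  _IsReductOf_ : Structure A → Structure A → Set
  N IsReductOf M = ∀ R → Definable M (rel N R)

  Interdefinable : Structure A → Structure A → Set
  Interdefinable M N = M IsReductOf N × N IsReductOf M

Permutation : Set → Set
Permutation A = A ↔ A

module _ {A : Set} where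

  Aut : Structure A → Pred (Permutation A) 0ℓ
  Aut M f = ∀ R v → rel M R v ⇔ rel M R (map (Inverse.to f) v)

  -- The subgroup generated by S. The constructor resp is needed because
  -- permutations with the same values need not be propositionally equal.
  data ⟨_⟩ (S : Pred (Permutation A) 0ℓ) : Pred (Permutation A) 0ℓ where
    gen  : ∀ {f} → S f → ⟨ S ⟩ f
    idn  : ⟨ S ⟩ (↔-id A)
    comp : ∀ {f g} → ⟨ S ⟩ f → ⟨ S ⟩ g → ⟨ S ⟩ (f ↔-∘ g)
    inv  : ∀ {f} → ⟨ S ⟩ f → ⟨ S ⟩ (↔-sym f)
    resp : ∀ {f g} → Inverse.to f ≗ Inverse.to g → ⟨ S ⟩ f → ⟨ S ⟩ g

GL : Pred (Permutation 𝔽₂^ω) 0ℓ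
GL f = IsLeftModuleHomomorphism rawLeftModule rawLeftModule (Inverse.to f)
  where open LeftModule 𝔽₂^ω-leftModule using (rawLeftModule)

Translation : Pred (Permutation 𝔽₂^ω) 0ℓ
Translation f = ∃[ a ] ∀ v → Inverse.to f v ≡ v ⊕ a

AGL : Pred (Permutation 𝔽₂^ω) 0ℓ
AGL = ⟨ GL ∪ Translation ⟩

Sym₀ : Pred (Permutation 𝔽₂^ω) 0ℓ
Sym₀ f = Inverse.to f 𝟎 ≡ 𝟎

Sym : Pred (Permutation 𝔽₂^ω) 0ℓ
Sym = U

-- The operations of the vector space enter as their graphs.
data VectorSpaceSymbol : Set where
  sum   : VectorSpaceSymbol
  zero  : VectorSpaceSymbol
  scale : Bool → VectorSpaceSymbol

vectorSpace : Structure 𝔽₂^ω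
vectorSpace .signature .Symbol          = VectorSpaceSymbol
vectorSpace .signature .arity sum       = 3
vectorSpace .signature .arity zero      = 1
vectorSpace .signature .arity (scale c) = 2
vectorSpace .rel sum       (a ∷ b ∷ d ∷ []) = a ⊕ b ≡ d
vectorSpace .rel zero      (a ∷ [])         = a ≡ 𝟎
vectorSpace .rel (scale c) (a ∷ b ∷ [])     = c · a ≡ b

data SingleSymbol : Set where
  ∙ : SingleSymbol

affineSpace : Structure 𝔽₂^ω
affineSpace .signature .Symbol  = SingleSymbol
affineSpace .signature .arity ∙ = 4
affineSpace .rel ∙ (a ∷ b ∷ c ∷ d ∷ []) = (a ⊕ b) ⊕ c ≡ d

pointedSet : Structure 𝔽₂^ω
pointedSet .signature .Symbol  = SingleSymbol
pointedSet .signature .arity ∙ = 1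
pointedSet .rel ∙ (a ∷ [])     = a ≡ 𝟎

trivial : Structure 𝔽₂^ω
trivial .signature .Symbol = ⊥
trivial .signature .arity ()
trivial .rel ()

reduct : Fin 4 → Structure 𝔽₂^ω
reduct zero                   = vectorSpace
reduct (suc zero)             = affineSpace
reduct (suc (suc zero))       = pointedSet
reduct (suc (suc (suc zero))) = trivial

{-# OPTIONS --safe #-}
module Submission where

-- By the Ryll-Nardzewski correspondence, a reduct N of the vector space is determined up to
-- interdefinability by G = Aut N, a closed group of permutations containing GL. If the stabilizer
-- of 0 in G is linear, then G is GL when it fixes 0. When it moves 0, fixing three of the points
-- 0, x, y, x + y fixes the fourth; the same holds for their images under f ∈ G, so each image is
-- in the span of the others, the four images sum to 0, and G is the affine group.
-- If some f in the stabilizer of 0 is not linear, then f breaks a circuit x, y, x + y, hence a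
-- circuit of length 4, hence one of every greater length; so, inductively, every tuple of distinct
-- nonzero vectors can be made independent by the stabilizer of 0, which is therefore dense in Sym₀.

open import Defs
open import Level using (0ℓ)
open import Axiom.ExcludedMiddle using (ExcludedMiddle)
open import Data.Product using (_×_; ∃-syntax; _,_; proj₁; proj₂)
open import Relation.Binary.PropositionalEquality
  using (_≡_; _≢_; refl; sym; trans; cong; cong₂; subst; subst₂)
open import Relation.Unary using (_≐_; Pred)
open import Algebra.Bundles using (CommutativeMonoid)
open import Algebra.Module.Bundles using (LeftModule)
open import Algebra.Module.Morphism.Structures using (module IsLeftModuleHomomorphism)
open import Data.Bool using (Bool; true; false; _xor_)
open import Data.Empty using (⊥; ⊥-elim)
open import Data.Fin using (Fin; zero; suc)
open import Data.Fin.Patterns using (0F; 1F; 2F; 3F)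
open import Data.List using (List; []; _∷_; _++_; concatMap) renaming (map to mapˡ)
open import Data.List.Membership.Propositional using (lose) renaming (_∈_ to _∈ˡ_; _∉_ to _∉ˡ_)
open import Data.List.Membership.Propositional.Properties
  using (∈-map⁺; ∈-++⁺ˡ; ∈-++⁺ʳ; ∈-concatMap⁺)
open import Data.List.Relation.Unary.Any using (here; there)
open import Data.Nat using (ℕ; zero; suc; _+_; _≤_; _⊔_; _≤′_; ≤′-refl; ≤′-step)
open import Data.Nat.Properties using (+-suc; ≤⇒≤′; m≤m⊔n; m≤n⊔m; ≤-trans; <-irrefl)
open import Data.Sum using (_⊎_; inj₁; inj₂)
open import Data.Unit using (⊤; tt)
open import Data.Vec using (Vec; []; _∷_; allFin; lookup; map; zipWith; replicate)
open import Data.Vec.Membership.Propositional using (_∈_; _∉_)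
open import Data.Vec.Properties
  using (∷-injectiveˡ; ∷-injectiveʳ; lookup-map; map-∘; map-cong; map-id; map-lookup-allFin)
import Data.Vec.Relation.Unary.Any as Any
open import Data.Vec.Relation.Unary.Any.Properties using (lookup-index)
open import Function using (_∘_; _⇔_; mk⇔; mk↔ₛ′; case_of_; Inverse; Equivalence)
open import Function.Construct.Composition using (_↔-∘_)
open import Function.Construct.Identity using (↔-id)
open import Function.Construct.Symmetry using (↔-sym)
open import Relation.Nullary using (¬_; Dec; does; yes; no)
open import Relation.Nullary.Decidable using (decidable-stable; does-⇔)

open Structure

-- To make x independent together with an independent tuple xs, there is one obstinate case. Over 𝔽₂
-- a combination is the sum of a subset of xs. If the subset misses an entry, linear permutations
-- can move that entry while they fix x and the rest, and induction applies. If x is the sum of all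
-- of xs, nothing is free, and linear permutations preserve the dependence: only a nonlinear f
-- helps, and it has to break a circuit of exactly that length. Hence the need for broken circuits
-- of all lengths. A single broken circuit cannot simply be lengthened, since nothing is known of f
-- at the new sum. Two tuples with equal sums whose images have different sums can: the same new
-- vector is put in front of both, and at the end f must fail on one of them.

private
  to : {A : Set} → Permutation A → A → A
  to = Inverse.to

  from : {A : Set} → Permutation A → A → A
  from = Inverse.from

-- Back-and-forth

-- Two instances matter: orbits under `Aut M`, which make definable relations invariant, and `_≃_`,
-- which bounds the number of types. Symmetry leaves only the forth half to prove and carries the
-- premise of an implication backwards.
record IsBackAndForth {A : Set} (M : Structure A)
                      (_∼_ : ∀ {n} → Vec A n → Vec A n → Set) : Set where
  field
    symm   : ∀ {n} {ρ ρ′ : Vec A n} → ρ ∼ ρ′ → ρ′ ∼ ρ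
    extend : ∀ {n} {ρ ρ′ : Vec A n} → ρ ∼ ρ′ → ∀ a → ∃[ b ] (a ∷ ρ) ∼ (b ∷ ρ′)
    atoms  : ∀ {n} {ρ ρ′ : Vec A n} → ρ ∼ ρ′ → ∀ R xs →
             rel M R (map (lookup ρ) xs) → rel M R (map (lookup ρ′) xs)
    equal  : ∀ {n} {ρ ρ′ : Vec A n} → ρ ∼ ρ′ → ∀ x y →
             lookup ρ x ≡ lookup ρ y → lookup ρ′ x ≡ lookup ρ′ y

  preserves : ∀ {n} (φ : Formula (signature M) n) {ρ ρ′} → ρ ∼ ρ′ →
              M ⊨ φ [ ρ ] → M ⊨ φ [ ρ′ ]
  preserves (atom R xs) r p         = atoms r R xs p
  preserves (x ≈ y)     r p         = equal r x y p
  preserves (φ ∧′ ψ)    r (p , q)   = preserves φ r p , preserves ψ r q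
  preserves (φ ∨′ ψ)    r (inj₁ p)  = inj₁ (preserves φ r p)
  preserves (φ ∨′ ψ)    r (inj₂ q)  = inj₂ (preserves ψ r q)
  preserves (φ ⇒′ ψ)    r p         = preserves ψ r ∘ p ∘ preserves φ (symm r)
  preserves (∀′ φ)      r p b with extend (symm r) b
  ... | a , r′ = preserves φ (symm r′) (p a)
  preserves (∃′ φ)      r (a , p) with extend r a
  ... | b , r′ = b , preserves φ r′ p

module _ {A : Set} where

  infix 4 _⊢_≼_

  _⊢_≼_ : ∀ (M : Structure A) {n} → Vec A n → Vec A n → Set
  M ⊢ ρ ≼ ρ′ = ∀ φ → M ⊨ φ [ ρ ] → M ⊨ φ [ ρ′ ]

  Invariant : ∀ {n} → Pred (Permutation A) 0ℓ → Pred (Vec A n) 0ℓ → Set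
  Invariant G P = ∀ f → G f → ∀ v → P v → P (map (to f) v)

  Aut-∘ : ∀ M {f g : Permutation A} → Aut M f → Aut M g → Aut M (f ↔-∘ g)
  Aut-∘ M {f} {g} F G R v = mk⇔
    (subst (rel M R) (sym (map-∘ (to f) (to g) v)) ∘
      Equivalence.to (F R _) ∘ Equivalence.to (G R v))
    (Equivalence.from (G R v) ∘ Equivalence.from (F R _) ∘
      subst (rel M R) (map-∘ (to f) (to g) v))

  map-to-from : ∀ (f : Permutation A) {n} (v : Vec A n) → map (to f) (map (from f) v) ≡ v
  map-to-from f v = trans (sym (map-∘ (to f) (from f) v))
    (trans (map-cong (Inverse.strictlyInverseˡ f) v) (map-id v))

  map-from-to : ∀ (f : Permutation A) {n} (v : Vec A n) → map (from f) (map (to f) v) ≡ v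
  map-from-to f = map-to-from (↔-sym f)

  Aut-sym : ∀ M {f : Permutation A} → Aut M f → Aut M (↔-sym f)
  Aut-sym M {f} F R v = mk⇔
    (Equivalence.from (F R _) ∘ subst (rel M R) (sym (map-to-from f v)))
    (subst (rel M R) (map-to-from f v) ∘ Equivalence.to (F R _))

  map-lookup-map : ∀ (f : A → A) {n k} (ρ : Vec A n) (xs : Vec (Fin n) k) →
                   map (lookup (map f ρ)) xs ≡ map f (map (lookup ρ) xs)
  map-lookup-map f ρ xs = trans (map-cong (λ i → lookup-map i f ρ) xs) (map-∘ f (lookup ρ) xs)

  Aut-orbit : ∀ (M : Structure A) {n} → Vec A n → Vec A n → Set
  Aut-orbit M ρ ρ′ = ∃[ f ] Aut M f × map (to f) ρ ≡ ρ′

  Aut-isBackAndForth : ∀ M → IsBackAndForth M (Aut-orbit M)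
  Aut-isBackAndForth M = record
    { symm   = λ { (f , F , refl) → ↔-sym f , Aut-sym M {f} F , map-from-to f _ }
    ; extend = λ { (f , F , refl) a → to f a , f , F , refl }
    ; atoms  = λ { {ρ = ρ} (f , F , refl) R xs →
        subst (rel M R) (sym (map-lookup-map (to f) ρ xs)) ∘ Equivalence.to (F R _) }
    ; equal  = λ { {ρ = ρ} (f , F , refl) x y p →
        trans (lookup-map x (to f) ρ) (trans (cong (to f) p) (sym (lookup-map y (to f) ρ))) }
    }

  Definable⇒Invariant : ∀ M {n} {P : Pred (Vec A n) 0ℓ} → Definable M P → Invariant (Aut M) P
  Definable⇒Invariant M (φ , P⊆φ , φ⊆P) f F v p =
    φ⊆P (IsBackAndForth.preserves (Aut-isBackAndForth M) φ (f , F , refl) (P⊆φ p))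

  Invariants⇒Aut⊆ : ∀ M N → (∀ R → Invariant (Aut M) (rel N R)) → ∀ {f} → Aut M f → Aut N f
  Invariants⇒Aut⊆ M N pres {f} F R v = mk⇔ (pres R f F v)
    (subst (rel N R) (map-from-to f v) ∘ pres R (↔-sym f) (Aut-sym M {f} F) _)

  reduct⇒Aut⊆ : ∀ M N → N IsReductOf M → ∀ {f} → Aut M f → Aut N f
  reduct⇒Aut⊆ M N red {f} =
    Invariants⇒Aut⊆ M N (λ R → Definable⇒Invariant M {P = rel N R} (red R)) {f}

-- The Ryll-Nardzewski correspondence

module RyllNardzewski
  (em : ExcludedMiddle 0ℓ) {A : Set}
  (enum : ℕ → A) (enum-surjective : ∀ a → ∃[ i ] enum i ≡ a)
  (M : Structure A)
  (finitelyManyTypes : ∀ n → ∃[ reps ] ∀ (ρ : Vec A n) → ∃[ r ] r ∈ˡ reps × M ⊢ r ≼ ρ)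
  where

  -- Types are complete: if φ failed at ρ, its negation would pass to ρ′.
  ≼-sym : ∀ {n} {ρ ρ′ : Vec A n} → M ⊢ ρ ≼ ρ′ → M ⊢ ρ′ ≼ ρ
  ≼-sym le φ p = decidable-stable em (λ ¬φ → le (φ ⇒′ ⊥′) ¬φ p)

  separate : ∀ {n} {ρ ρ′ : Vec A n} → ¬ (M ⊢ ρ ≼ ρ′) →
             ∃[ φ ] M ⊨ φ [ ρ ] × ¬ (M ⊨ φ [ ρ′ ])
  separate ¬le = decidable-stable em λ none →
    ¬le λ φ p → decidable-stable em λ ¬q → none (φ , p , ¬q)

  isolate-among : ∀ {n} (ρ : Vec A n) reps →
    ∃[ φ ] M ⊨ φ [ ρ ] × (∀ r → r ∈ˡ reps → M ⊨ φ [ r ] → M ⊢ ρ ≼ r)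
  isolate-among ρ []       = (⊥′ ⇒′ ⊥′) , (λ ()) , λ _ ()
  isolate-among ρ (r ∷ rs) with isolate-among ρ rs | em {M ⊢ ρ ≼ r}
  ... | φ , p , h | yes le = φ , p , λ { _ (here refl) _ → le ; s (there s∈) q → h s s∈ q }
  ... | φ , p , h | no ¬le with separate ¬le
  ...   | ψ , q , ¬ψ = (ψ ∧′ φ) , (q , p) , λ
    { _ (here refl) (q′ , _) → ⊥-elim (¬ψ q′)
    ; s (there s∈) (_ , p′) → h s s∈ p′ }

  -- Excluding the finitely many listed types other than that of ρ is enough: any ρ′ has the type of
  -- a listed r, and if ρ′ satisfies φ then so does r.
  isolate : ∀ {n} (ρ : Vec A n) → ∃[ φ ] M ⊨ φ [ ρ ] × (∀ ρ′ → M ⊨ φ [ ρ′ ] → M ⊢ ρ ≼ ρ′)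
  isolate {n} ρ with finitelyManyTypes n
  ... | reps , represent with isolate-among ρ reps
  ...   | φ , p , h = φ , p , λ ρ′ q → let (r , r∈ , le) = represent ρ′ in
    λ ψ s → le ψ (h r r∈ (≼-sym le φ q) ψ s)

  -- P is a union of types, of which there are finitely many; the disjunction of formulas isolating
  -- them defines it.
  invariant⇒definable : ∀ {n} {P : Pred (Vec A n) 0ℓ} →
    (∀ {ρ ρ′} → M ⊢ ρ ≼ ρ′ → P ρ → P ρ′) → Definable M P
  invariant⇒definable {n} {P} stable with finitelyManyTypes n
  ... | reps , represent with disjunction reps
    where
    disjunction : ∀ rs → ∃[ φ ] (∀ ρ → M ⊨ φ [ ρ ] → P ρ) × (∀ r → r ∈ˡ rs → P r → M ⊨ φ [ r ])
    disjunction []       = ⊥′ , (λ _ ()) , λ _ ()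
    disjunction (r ∷ rs) with disjunction rs | em {P r}
    ... | φ , sound , complete | no ¬p = φ , sound , λ
      { _ (here refl) p → ⊥-elim (¬p p) ; s (there s∈) p → complete s s∈ p }
    ... | φ , sound , complete | yes p with isolate r
    ...   | ψ , q , iso = (ψ ∨′ φ) ,
      (λ { ρ (inj₁ t) → stable (iso ρ t) p ; ρ (inj₂ t) → sound ρ t }) , λ
      { _ (here refl) _ → inj₁ q ; s (there s∈) p′ → inj₂ (complete s s∈ p′) }
  ...   | φ , sound , complete = φ ,
    (λ {ρ} p → let (r , r∈ , le) = represent ρ in le φ (complete r r∈ (stable (≼-sym le) p))) ,
    (λ {ρ} → sound ρ)

  -- The whole type of `a ∷ ρ` is packed into one isolating formula, so its existential
  -- quantification is a single statement that passes from ρ to ρ′.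
  ≼-extend : ∀ {n} {ρ ρ′ : Vec A n} → M ⊢ ρ ≼ ρ′ → ∀ a → ∃[ b ] M ⊢ a ∷ ρ ≼ b ∷ ρ′
  ≼-extend {ρ = ρ} le a with isolate (a ∷ ρ)
  ... | φ , p , iso with le (∃′ φ) (a , p)
  ...   | b , q = b , iso _ q

  record PartialMap : Set where
    constructor partialMap
    field
      {size}     : ℕ
      pairs      : Vec (A × A) size
      elementary : M ⊢ map proj₁ pairs ≼ map proj₂ pairs

  open PartialMap

  forth back : PartialMap → A → PartialMap
  forth (partialMap ps le) a =
    let (b , le′) = ≼-extend le a in partialMap ((a , b) ∷ ps) le′
  back (partialMap ps le) b =
    let (a , le′) = ≼-extend (≼-sym le) b in partialMap ((a , b) ∷ ps) (≼-sym le′)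

  module _ (start : PartialMap) where

    stage : ℕ → PartialMap
    stage zero    = start
    stage (suc i) = back (forth (stage i) (enum i)) (enum i)

    stage-mono : ∀ {i j p} → i ≤′ j → p ∈ pairs (stage i) → p ∈ pairs (stage j)
    stage-mono ≤′-refl       p∈ = p∈
    stage-mono (≤′-step i≤j) p∈ = Any.there (Any.there (stage-mono i≤j p∈))

    _↦_ : A → A → Set
    a ↦ b = ∃[ i ] (a , b) ∈ pairs (stage i)

    value : ∀ a → ∃[ b ] a ↦ b
    value a with enum-surjective a
    -- Within one stage the pair from `forth` lies below the pair that `back` puts on top.
    ... | i , refl = _ , suc i , Any.there (Any.here refl)

    preimage : ∀ b → ∃[ a ] a ↦ b
    preimage b with enum-surjective b
    ... | i , refl = _ , suc i , Any.here refl

    lookup-pairs : ∀ {n a b} {ps : Vec (A × A) n} → (a , b) ∈ ps →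
      ∃[ i ] lookup (map proj₁ ps) i ≡ a × lookup (map proj₂ ps) i ≡ b
    lookup-pairs (Any.here refl) = zero , refl , refl
    lookup-pairs (Any.there p∈) with lookup-pairs p∈
    ... | i , p , q = suc i , p , q

    -- Brings all entries of v among the variables of one stage, so that a relation at v becomes an
    -- atomic formula, which the stage preserves.
    covering-stage : ∀ {n} (v : Vec A n) (f : A → A) → (∀ a → a ↦ f a) →
      ∃[ i ] ∃[ xs ] map (lookup (map proj₁ (pairs (stage i)))) xs ≡ v
                   × map (lookup (map proj₂ (pairs (stage i)))) xs ≡ map f v
    covering-stage v f graph = let (i , h) = bound v in
      i , indices i v h
      where
      bound : ∀ {n} (v : Vec A n) → ∃[ i ] (∀ {a} → a ∈ v → (a , f a) ∈ pairs (stage i))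
      bound []      = 0 , λ ()
      bound (a ∷ v) with bound v | graph a
      ... | i , h | j , a∈ = i ⊔ j , λ
        { (Any.here refl) → stage-mono (≤⇒≤′ (m≤n⊔m i j)) a∈
        ; (Any.there b∈)  → stage-mono (≤⇒≤′ (m≤m⊔n i j)) (h b∈) }

      indices : ∀ {n} i (v : Vec A n) → (∀ {a} → a ∈ v → (a , f a) ∈ pairs (stage i)) →
        ∃[ xs ] map (lookup (map proj₁ (pairs (stage i)))) xs ≡ v
              × map (lookup (map proj₂ (pairs (stage i)))) xs ≡ map f v
      indices i []      h = [] , refl , refl
      indices i (a ∷ v) h with lookup-pairs (h (Any.here refl)) | indices i v (h ∘ Any.there)
      ... | x , p , q | xs , ps , qs = x ∷ xs , cong₂ _∷_ p ps , cong₂ _∷_ q qs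

    common-stage : ∀ {a b c d} → a ↦ b → c ↦ d →
      ∃[ i ] (a , b) ∈ pairs (stage i) × (c , d) ∈ pairs (stage i)
    common-stage (i , p) (j , q) =
      i ⊔ j , stage-mono (≤⇒≤′ (m≤m⊔n i j)) p , stage-mono (≤⇒≤′ (m≤n⊔m i j)) q

    -- Equality of two entries is itself a formula, and some stage contains both pairs.
    ↦-functional : ∀ {a b c} → a ↦ b → a ↦ c → b ≡ c
    ↦-functional r s with common-stage r s
    ... | i , p , q with lookup-pairs p | lookup-pairs q
    ...   | x , x₁ , x₂ | y , y₁ , y₂ =
      trans (sym x₂) (trans (elementary (stage i) (x ≈ y) (trans x₁ (sym y₁))) y₂)

    ↦-injective : ∀ {a b c} → a ↦ c → b ↦ c → a ≡ b
    ↦-injective r s with common-stage r s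
    ... | i , p , q with lookup-pairs p | lookup-pairs q
    ...   | x , x₁ , x₂ | y , y₁ , y₂ =
      trans (sym x₁) (trans (≼-sym (elementary (stage i)) (x ≈ y) (trans x₂ (sym y₂))) y₁)

    limit : Permutation A
    limit = mk↔ₛ′ (proj₁ ∘ value) (proj₁ ∘ preimage)
      (λ b → ↦-functional (proj₂ (value _)) (proj₂ (preimage b)))
      (λ a → ↦-injective (proj₂ (preimage _)) (proj₂ (value a)))

    limit-aut : Aut M limit
    limit-aut R v with covering-stage v (to limit) (proj₂ ∘ value)
    ... | i , xs , p , q = mk⇔
      (subst₂ (λ v w → rel M R v → rel M R w) p q (elementary (stage i) (atom R xs)))
      (subst₂ (λ v w → rel M R v → rel M R w) q p (≼-sym (elementary (stage i)) (atom R xs)))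

    limit-extends : ∀ {a b} → (a , b) ∈ pairs start → to limit a ≡ b
    limit-extends p∈ = ↦-functional (proj₂ (value _)) (0 , p∈)

  abstract

    homogeneous : ∀ {n} {ρ ρ′ : Vec A n} → M ⊢ ρ ≼ ρ′ → Aut-orbit M ρ ρ′
    homogeneous {ρ = ρ} {ρ′} le =
      limit start , limit-aut start , values (to (limit start)) ρ ρ′ (limit-extends start)
      where
      map-proj₁-zip : ∀ {n} (v w : Vec A n) → map proj₁ (zipWith _,_ v w) ≡ v
      map-proj₁-zip []      []      = refl
      map-proj₁-zip (a ∷ v) (b ∷ w) = cong (a ∷_) (map-proj₁-zip v w)

      map-proj₂-zip : ∀ {n} (v w : Vec A n) → map proj₂ (zipWith _,_ v w) ≡ w
      map-proj₂-zip []      []      = refl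
      map-proj₂-zip (a ∷ v) (b ∷ w) = cong (b ∷_) (map-proj₂-zip v w)

      start : PartialMap
      start = partialMap (zipWith _,_ ρ ρ′)
        (subst₂ (M ⊢_≼_) (sym (map-proj₁-zip ρ ρ′)) (sym (map-proj₂-zip ρ ρ′)) le)

      values : ∀ {n} f (v w : Vec A n) → (∀ {a b} → (a , b) ∈ zipWith _,_ v w → f a ≡ b) →
               map f v ≡ w
      values f []      []      h = refl
      values f (a ∷ v) (b ∷ w) h = cong₂ _∷_ (h (Any.here refl)) (values f v w (h ∘ Any.there))

    Aut-invariant⇒definable : ∀ {n} {P : Pred (Vec A n) 0ℓ} → Invariant (Aut M) P → Definable M P
    Aut-invariant⇒definable {P = P} stable = invariant⇒definable λ {ρ} le p →
      let (f , F , eq) = homogeneous le in subst P eq (stable f F ρ p)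

-- Linear algebra over 𝔽₂

open import Algebra.Properties.CommutativeSemigroup
  (CommutativeMonoid.commutativeSemigroup (LeftModule.+ᴹ-commutativeMonoid 𝔽₂^ω-leftModule))
  using () renaming (interchange to ⊕-interchange)

lincomb : ∀ {n} → Vec Bool n → Vec 𝔽₂^ω n → 𝔽₂^ω
lincomb []      []       = 𝟎
lincomb (c ∷ k) (x ∷ xs) = c · x ⊕ lincomb k xs

lincomb-xor : ∀ {n} (k l : Vec Bool n) xs →
              lincomb (zipWith _xor_ k l) xs ≡ lincomb k xs ⊕ lincomb l xs
lincomb-xor []      []      []       = refl
lincomb-xor (c ∷ k) (d ∷ l) (x ∷ xs) =
  trans (cong₂ _⊕_ (·-distribʳ x c d) (lincomb-xor k l xs))
    (⊕-interchange (c · x) (d · x) (lincomb k xs) (lincomb l xs))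

lincomb-0 : ∀ {n} (xs : Vec 𝔽₂^ω n) → lincomb (replicate n false) xs ≡ 𝟎
lincomb-0 []       = refl
lincomb-0 (x ∷ xs) = lincomb-0 xs

unit : ∀ {n} → Fin n → Vec Bool n
unit zero    = true ∷ replicate _ false
unit (suc i) = false ∷ unit i

lincomb-unit : ∀ {n} (i : Fin n) xs → lincomb (unit i) xs ≡ lookup xs i
lincomb-unit zero    (x ∷ xs) = trans (cong (x ⊕_) (lincomb-0 xs)) (⊕-identityʳ x)
lincomb-unit (suc i) (x ∷ xs) = lincomb-unit i xs

⊕≡𝟎⇒≡ : ∀ {x y} → x ⊕ y ≡ 𝟎 → x ≡ y
⊕≡𝟎⇒≡ {x} {y} p = trans (sym (⊕-identityʳ x)) (trans (cong (x ⊕_) (sym (⊕-self y)))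
  (trans (sym (⊕-assoc x y y)) (cong (_⊕ y) p)))

≡⇒⊕≡𝟎 : ∀ {x y} → x ≡ y → x ⊕ y ≡ 𝟎
≡⇒⊕≡𝟎 {x} refl = ⊕-self x

-- Linear identities by comparison of coefficients

infix  8 #_
infixl 6 _⊞_

data Expr (n : ℕ) : Set where
  #_  : Fin n → Expr n
  𝕠   : Expr n
  _⊞_ : Expr n → Expr n → Expr n

⟦_⟧_ : ∀ {n} → Expr n → Vec 𝔽₂^ω n → 𝔽₂^ω
⟦ # i ⟧   ρ = lookup ρ i
⟦ 𝕠 ⟧     ρ = 𝟎
⟦ e ⊞ d ⟧ ρ = ⟦ e ⟧ ρ ⊕ ⟦ d ⟧ ρ

coeffs : ∀ {n} → Expr n → Vec Bool n
coeffs (# i)   = unit i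
coeffs 𝕠       = replicate _ false
coeffs (e ⊞ d) = zipWith _xor_ (coeffs e) (coeffs d)

lincomb-coeffs : ∀ {n} (e : Expr n) ρ → lincomb (coeffs e) ρ ≡ ⟦ e ⟧ ρ
lincomb-coeffs (# i)   ρ = lincomb-unit i ρ
lincomb-coeffs 𝕠       ρ = lincomb-0 ρ
lincomb-coeffs (e ⊞ d) ρ = trans (lincomb-xor (coeffs e) (coeffs d) ρ)
  (cong₂ _⊕_ (lincomb-coeffs e ρ) (lincomb-coeffs d ρ))

solve : ∀ {n} (e d : Expr n) ρ → coeffs e ≡ coeffs d → ⟦ e ⟧ ρ ≡ ⟦ d ⟧ ρ
solve e d ρ eq = trans (sym (lincomb-coeffs e ρ))
  (trans (cong (λ k → lincomb k ρ) eq) (lincomb-coeffs d ρ))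

-- In characteristic 2 an equation says that the sum of its sides is 0, so two equations whose sides
-- add up to the same coefficients are equivalent.
solve-from : ∀ {n} (e e′ d d′ : Expr n) ρ → coeffs (e ⊞ e′) ≡ coeffs (d ⊞ d′) →
             ⟦ e ⟧ ρ ≡ ⟦ e′ ⟧ ρ → ⟦ d ⟧ ρ ≡ ⟦ d′ ⟧ ρ
solve-from e e′ d d′ ρ eq p =
  ⊕≡𝟎⇒≡ (trans (sym (solve (e ⊞ e′) (d ⊞ d′) ρ eq)) (≡⇒⊕≡𝟎 p))

-- Spans and vectors outside them

infix 4 _∈⟨_⟩ _∉⟨_⟩ _≃_

_∈⟨_⟩ _∉⟨_⟩ : ∀ {n} → 𝔽₂^ω → Vec 𝔽₂^ω n → Set
x ∈⟨ xs ⟩ = ∃[ k ] lincomb k xs ≡ x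
x ∉⟨ xs ⟩ = ¬ x ∈⟨ xs ⟩

span : ∀ {n} → Vec 𝔽₂^ω n → List 𝔽₂^ω
span []       = 𝟎 ∷ []
span (x ∷ xs) = span xs ++ mapˡ (x ⊕_) (span xs)

lincomb∈span : ∀ {n} (k : Vec Bool n) xs → lincomb k xs ∈ˡ span xs
lincomb∈span []          []       = here refl
lincomb∈span (false ∷ k) (x ∷ xs) = ∈-++⁺ˡ (lincomb∈span k xs)
lincomb∈span (true ∷ k)  (x ∷ xs) = ∈-++⁺ʳ (span xs) (∈-map⁺ (x ⊕_) (lincomb∈span k xs))

∉span⇒∉⟨⟩ : ∀ {n x} {xs : Vec 𝔽₂^ω n} → x ∉ˡ span xs → x ∉⟨ xs ⟩
∉span⇒∉⟨⟩ x∉ (k , refl) = x∉ (lincomb∈span k _)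

length⁺ : NonzeroSeq → ℕ
length⁺ [1]     = 0
length⁺ (b ∷ v) = suc (length⁺ v)

e⁺ : ℕ → NonzeroSeq
e⁺ zero    = [1]
e⁺ (suc i) = false ∷ e⁺ i

length-e⁺ : ∀ i → length⁺ (e⁺ i) ≡ i
length-e⁺ zero    = refl
length-e⁺ (suc i) = cong suc (length-e⁺ i)

length⁰ : 𝔽₂^ω → ℕ
-- `𝟎` shares this value with `[1]`; that does no harm, because `avoid` takes a length above all
-- those in the list.
length⁰ 𝟎      = 0
length⁰ (nz v) = length⁺ v

abstract

  -- The witness is a unit vector whose 1 stands beyond the last 1 of every listed vector.
  avoid : ∀ (xs : List 𝔽₂^ω) → ∃[ w ] w ∉ˡ xs
  avoid xs = nz (e⁺ (suc (bound xs))) , λ e∈ → <-irrefl {bound xs} refl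
    (subst (_≤ bound xs) (length-e⁺ (suc (bound xs))) (≤-bound {xs = xs} e∈))
    where
    bound : List 𝔽₂^ω → ℕ
    bound []       = 0
    bound (x ∷ xs) = length⁰ x ⊔ bound xs

    ≤-bound : ∀ {x xs} → x ∈ˡ xs → length⁰ x ≤ bound xs
    ≤-bound {xs = x ∷ xs} (here refl) = m≤m⊔n (length⁰ x) (bound xs)
    ≤-bound {xs = x ∷ xs} (there y∈)  = ≤-trans (≤-bound y∈) (m≤n⊔m (length⁰ x) (bound xs))

-- The orbits of GL on tuples.
_≃_ : ∀ {n} → Vec 𝔽₂^ω n → Vec 𝔽₂^ω n → Set
xs ≃ ys = ∀ k → lincomb k xs ≡ 𝟎 ⇔ lincomb k ys ≡ 𝟎

≃-sym : ∀ {n} {xs ys : Vec 𝔽₂^ω n} → xs ≃ ys → ys ≃ xs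
≃-sym s k = mk⇔ (Equivalence.from (s k)) (Equivalence.to (s k))

≃-equation : ∀ {n} {xs ys : Vec 𝔽₂^ω n} → xs ≃ ys → ∀ (e d : Expr n) →
             ⟦ e ⟧ xs ≡ ⟦ d ⟧ xs → ⟦ e ⟧ ys ≡ ⟦ d ⟧ ys
≃-equation {xs = xs} {ys} s e d p = ⊕≡𝟎⇒≡ (trans (sym (lincomb-coeffs (e ⊞ d) ys))
  (Equivalence.to (s (coeffs (e ⊞ d))) (trans (lincomb-coeffs (e ⊞ d) xs) (≡⇒⊕≡𝟎 p))))

≃-dependent : ∀ {n} {xs ys : Vec 𝔽₂^ω n} → xs ≃ ys → ∀ k →
              (lincomb k xs ∷ xs) ≃ (lincomb k ys ∷ ys)
≃-dependent s k (false ∷ l) = s l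
≃-dependent {xs = xs} {ys} s k (true ∷ l) =
  subst₂ (λ x y → x ≡ 𝟎 ⇔ y ≡ 𝟎) (lincomb-xor k l xs) (lincomb-xor k l ys) (s (zipWith _xor_ k l))

-- A dependence that involves the head would put it into the span of the tail, so on both sides only
-- the dependences of the tails remain.
≃-independent : ∀ {n x y} {xs ys : Vec 𝔽₂^ω n} → xs ≃ ys → x ∉⟨ xs ⟩ → y ∉⟨ ys ⟩ →
                (x ∷ xs) ≃ (y ∷ ys)
≃-independent s x∉ y∉ (false ∷ l) = s l
≃-independent s x∉ y∉ (true ∷ l)  = mk⇔
  (λ p → ⊥-elim (x∉ (l , sym (⊕≡𝟎⇒≡ p)))) (λ p → ⊥-elim (y∉ (l , sym (⊕≡𝟎⇒≡ p))))

≃-refl : ∀ {n} {xs : Vec 𝔽₂^ω n} → xs ≃ xs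
≃-refl k = mk⇔ (λ p → p) (λ p → p)

outside : ∀ {n} → Vec 𝔽₂^ω n → 𝔽₂^ω
outside xs = proj₁ (avoid (span xs))

outside-∉ : ∀ {n} (xs : Vec 𝔽₂^ω n) → outside xs ∉⟨ xs ⟩
outside-∉ xs = ∉span⇒∉⟨⟩ (proj₂ (avoid (span xs)))

-- Up to `_≃_` these are all the extensions by one vector: the finitely many vectors of the span,
-- and one vector outside it, since all outside vectors are alike.
extensions : ∀ {n} → Vec 𝔽₂^ω n → List 𝔽₂^ω
extensions xs = outside xs ∷ span xs

representatives : ∀ n → List (Vec 𝔽₂^ω n)
representatives zero    = [] ∷ []
representatives (suc n) = concatMap (λ xs → mapˡ (_∷ xs) (extensions xs)) (representatives n)

-- Types of tuples in reducts of the vector space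

module Linear (em : ExcludedMiddle 0ℓ) where

  ≃-extend-among : ∀ {n} {xs ys : Vec 𝔽₂^ω n} → xs ≃ ys → ∀ x →
                   ∃[ y ] y ∈ˡ extensions ys × (x ∷ xs) ≃ (y ∷ ys)
  ≃-extend-among {xs = xs} {ys} s x with em {x ∈⟨ xs ⟩}
  ... | yes (k , refl) = lincomb k ys , there (lincomb∈span k ys) , ≃-dependent s k
  ... | no x∉ = outside ys , here refl , ≃-independent s x∉ (outside-∉ ys)

  represent : ∀ {n} (xs : Vec 𝔽₂^ω n) → ∃[ r ] r ∈ˡ representatives n × xs ≃ r
  represent []       = [] , here refl , ≃-refl
  represent (x ∷ xs) with represent xs
  ... | r , r∈ , s with ≃-extend-among s x
  ...   | y , y∈ , t = y ∷ r ,
    ∈-concatMap⁺ (λ xs → mapˡ (_∷ xs) (extensions xs))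
      (lose r∈ (∈-map⁺ (_∷ r) y∈)) , t

  ≃-isBackAndForth-vectorSpace : IsBackAndForth vectorSpace _≃_
  ≃-isBackAndForth-vectorSpace = record
    { symm   = ≃-sym
    ; extend = λ s x → let (y , _ , t) = ≃-extend-among s x in y , t
    ; atoms  = λ where
        s sum           (x ∷ y ∷ z ∷ []) → ≃-equation s (# x ⊞ # y) (# z)
        s zero          (x ∷ [])         → ≃-equation s (# x) 𝕠
        s (scale false) (x ∷ y ∷ [])     → ≃-equation s 𝕠 (# y)
        s (scale true)  (x ∷ y ∷ [])     → ≃-equation s (# x) (# y)
    ; equal  = λ s x y → ≃-equation s (# x) (# y)
    }

  -- An atom of N is a vector space formula at a selection of entries, possibly with repetitions.
  -- `pull` turns a dependence among the selected entries into one among all of ρ, so selecting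
  -- entries respects `_≃_`.
  ≃-isBackAndForth : ∀ N → N IsReductOf vectorSpace → IsBackAndForth N _≃_
  ≃-isBackAndForth N red = record
    { symm   = ≃-sym
    ; extend = extend
    ; atoms  = λ {_} {ρ} {ρ′} s R xs p → let (φ , N⊆φ , φ⊆N) = red R in
        φ⊆N (preserves φ (≃-map-lookup s xs) (N⊆φ p))
    ; equal  = equal
    }
    where
    open IsBackAndForth ≃-isBackAndForth-vectorSpace
    pull : ∀ {n m} → Vec (Fin n) m → Vec Bool m → Expr n
    pull []       []          = 𝕠
    pull (x ∷ xs) (false ∷ k) = pull xs k
    pull (x ∷ xs) (true ∷ k)  = # x ⊞ pull xs k

    ⟦pull⟧ : ∀ {n m} (ρ : Vec 𝔽₂^ω n) (xs : Vec (Fin n) m) k →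
             ⟦ pull xs k ⟧ ρ ≡ lincomb k (map (lookup ρ) xs)
    ⟦pull⟧ ρ []       []          = refl
    ⟦pull⟧ ρ (x ∷ xs) (false ∷ k) = ⟦pull⟧ ρ xs k
    ⟦pull⟧ ρ (x ∷ xs) (true ∷ k)  = cong (lookup ρ x ⊕_) (⟦pull⟧ ρ xs k)

    ≃-map-lookup : ∀ {n m} {ρ ρ′ : Vec 𝔽₂^ω n} → ρ ≃ ρ′ → (xs : Vec (Fin n) m) →
                   map (lookup ρ) xs ≃ map (lookup ρ′) xs
    ≃-map-lookup {ρ = ρ} {ρ′} s xs k = mk⇔ (half s) (half (≃-sym s))
      where
      half : ∀ {ρ ρ′} → ρ ≃ ρ′ →
             lincomb k (map (lookup ρ) xs) ≡ 𝟎 → lincomb k (map (lookup ρ′) xs) ≡ 𝟎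
      half {ρ} {ρ′} s p = trans (sym (⟦pull⟧ ρ′ xs k))
        (≃-equation s (pull xs k) 𝕠 (trans (⟦pull⟧ ρ xs k) p))

-- Binary numerals with the least significant digit first.
increment : 𝔽₂^ω → 𝔽₂^ω
increment 𝟎      = nz [1]
increment (nz v) = nz (increment⁺ v)
  where
  increment⁺ : NonzeroSeq → NonzeroSeq
  increment⁺ [1]         = false ∷ [1]
  increment⁺ (false ∷ v) = true ∷ v
  increment⁺ (true ∷ v)  = false ∷ increment⁺ v

binary : ℕ → 𝔽₂^ω
binary zero    = 𝟎
binary (suc n) = increment (binary n)

increment-even : ∀ v → increment (cons false v) ≡ cons true v
increment-even 𝟎      = refl
increment-even (nz v) = refl

increment-odd : ∀ v → increment (cons true v) ≡ cons false (increment v)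
increment-odd 𝟎      = refl
increment-odd (nz v) = refl

binary-double : ∀ n → binary (n + n) ≡ cons false (binary n)
binary-double zero    = refl
binary-double (suc n) = trans (cong (increment ∘ binary) (+-suc n n))
  (trans (cong (increment ∘ increment) (binary-double n))
  (trans (cong increment (increment-even (binary n))) (increment-odd (binary n))))

-- Provides the enumeration along which the back-and-forth construction runs.
binary-surjective : ∀ v → ∃[ n ] binary n ≡ v
binary-surjective 𝟎      = 0 , refl
binary-surjective (nz v) = positive v
  where
  positive : ∀ v → ∃[ n ] binary n ≡ nz v
  positive [1]     = 1 , refl
  positive (b ∷ v) with positive v
  positive (false ∷ v) | n , p = n + n , trans (binary-double n) (cong (cons false) p)
  positive (true ∷ v)  | n , p = suc (n + n) ,
    trans (cong increment (binary-double n))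
      (trans (increment-even (binary n)) (cong (cons true) p))

module ReductOfVectorSpace (em : ExcludedMiddle 0ℓ) (N : Structure 𝔽₂^ω)
                           (red : N IsReductOf vectorSpace) where

  open Linear em

  ≃⇒≼ : ∀ {n} {xs ys : Vec 𝔽₂^ω n} → xs ≃ ys → N ⊢ xs ≼ ys
  ≃⇒≼ s φ = IsBackAndForth.preserves (≃-isBackAndForth N red) φ s

  finitelyManyTypes : ∀ n → ∃[ reps ] ∀ (xs : Vec 𝔽₂^ω n) → ∃[ r ] r ∈ˡ reps × N ⊢ r ≼ xs
  finitelyManyTypes n = representatives n ,
    λ xs → let (r , r∈ , s) = represent xs in r , r∈ , ≃⇒≼ (≃-sym s)

  open RyllNardzewski em binary binary-surjective N finitelyManyTypes
    public using (homogeneous; Aut-invariant⇒definable)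

-- Linear permutations

module _ {A : Set} (f : Permutation A) where

  to-from : ∀ x → to f (from f x) ≡ x
  to-from = Inverse.strictlyInverseˡ f

  from-to : ∀ x → from f (to f x) ≡ x
  from-to = Inverse.strictlyInverseʳ f

  to-injective : ∀ {x y} → to f x ≡ to f y → x ≡ y
  to-injective {x} {y} p = trans (sym (from-to x)) (trans (cong (from f) p) (from-to y))

  to-≡⇒from : ∀ {x y} → to f x ≡ y → from f y ≡ x
  to-≡⇒from {x} refl = from-to x

-- Stands in for `GL` because homogeneity yields automorphisms of a structure; `Linear⊆GL` and
-- `GL⊆Linear` identify the two.
Linear : Pred (Permutation 𝔽₂^ω) 0ℓ
Linear = Aut vectorSpace

Additive : Pred (Permutation 𝔽₂^ω) 0ℓ
Additive f = ∀ x y → to f (x ⊕ y) ≡ to f x ⊕ to f y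

linear⇒additive : ∀ {f} → Linear f → Additive f
linear⇒additive F x y = sym (Equivalence.to (F sum (x ∷ y ∷ _ ∷ [])) refl)

additive-𝟎 : ∀ {f} → Additive f → to f 𝟎 ≡ 𝟎
additive-𝟎 {f} add = trans (cong (to f) (sym (⊕-self 𝟎))) (trans (add 𝟎 𝟎) (⊕-self (to f 𝟎)))

additive-· : ∀ {f} → Additive f → ∀ c x → to f (c · x) ≡ c · to f x
additive-· {f} add false x = additive-𝟎 {f} add
additive-· {f} add true  x = refl

additive⇒linear : ∀ {f} → Additive f → Linear f
additive⇒linear {f} add sum (x ∷ y ∷ z ∷ []) = mk⇔
  (λ p → trans (sym (add x y)) (cong (to f) p))
  (λ p → to-injective f (trans (add x y) p))
additive⇒linear {f} add zero (x ∷ []) = mk⇔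
  (λ p → trans (cong (to f) p) (additive-𝟎 {f} add))
  (λ p → to-injective f (trans p (sym (additive-𝟎 {f} add))))
additive⇒linear {f} add (scale c) (x ∷ y ∷ []) = mk⇔
  (λ p → trans (sym (additive-· {f} add c x)) (cong (to f) p))
  (λ p → to-injective f (trans (additive-· {f} add c x) p))

linear-𝟎 : ∀ {f} → Linear f → to f 𝟎 ≡ 𝟎
linear-𝟎 {f} F = additive-𝟎 {f} (linear⇒additive {f} F)

linear-lincomb : ∀ {f} → Linear f → ∀ {n} (k : Vec Bool n) xs →
                 to f (lincomb k xs) ≡ lincomb k (map (to f) xs)
linear-lincomb {f} F []      []       = linear-𝟎 {f} F
linear-lincomb {f} F (c ∷ k) (x ∷ xs) =
  trans (linear⇒additive {f} F (c · x) (lincomb k xs))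
    (cong₂ _⊕_ (additive-· {f} (linear⇒additive {f} F) c x) (linear-lincomb {f} F k xs))

vectorSpace-reduct : vectorSpace IsReductOf vectorSpace
vectorSpace-reduct R = atom R (allFin _) ,
  (λ {v} → subst (rel vectorSpace R) (sym (map-lookup-allFin v))) ,
  (λ {v} → subst (rel vectorSpace R) (map-lookup-allFin v))

-- Linear independence

Independent : ∀ {n} → Vec 𝔽₂^ω n → Set
Independent []       = ⊤
Independent (x ∷ xs) = x ∉⟨ xs ⟩ × Independent xs

independent-≃ : ∀ {n} (xs ys : Vec 𝔽₂^ω n) → Independent xs → Independent ys → xs ≃ ys
independent-≃ []       []       _        _        = ≃-refl
independent-≃ (x ∷ xs) (y ∷ ys) (x∉ , I) (y∉ , J) =
  ≃-independent (independent-≃ xs ys I J) x∉ y∉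

total : ∀ {n} → Vec 𝔽₂^ω n → 𝔽₂^ω
total = lincomb (replicate _ true)

≢𝟎⇒independent : ∀ {x} → x ≢ 𝟎 → Independent (x ∷ [])
≢𝟎⇒independent x≢𝟎 = (λ { ([] , p) → x≢𝟎 (sym p) }) , tt

≢⇒independent : ∀ {x y} → x ≢ 𝟎 → y ≢ 𝟎 → x ≢ y → Independent (x ∷ y ∷ [])
≢⇒independent {x} {y} x≢𝟎 y≢𝟎 x≢y = (λ
  { (false ∷ [] , p) → x≢𝟎 (sym p)
  ; (true  ∷ [] , p) → x≢y (trans (sym p) (⊕-identityʳ y)) }) , ≢𝟎⇒independent y≢𝟎

∈⇒∈⟨⟩ : ∀ {n x} {xs : Vec 𝔽₂^ω n} → x ∈ xs → x ∈⟨ xs ⟩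
∈⇒∈⟨⟩ {xs = xs} x∈ = unit (Any.index x∈) ,
  trans (lincomb-unit (Any.index x∈) xs) (sym (lookup-index x∈))

𝟎∈⟨⟩ : ∀ {n} (xs : Vec 𝔽₂^ω n) → 𝟎 ∈⟨ xs ⟩
𝟎∈⟨⟩ xs = replicate _ false , lincomb-0 xs

DistinctNonzero : ∀ {n} → Vec 𝔽₂^ω n → Set
DistinctNonzero []       = ⊤
DistinctNonzero (x ∷ xs) = x ∉ (𝟎 ∷ xs) × DistinctNonzero xs

∉⟨⟩⇒∉ : ∀ {n x} {xs : Vec 𝔽₂^ω n} → x ∉⟨ xs ⟩ → x ∉ (𝟎 ∷ xs)
∉⟨⟩⇒∉ x∉ (Any.here refl) = x∉ (𝟎∈⟨⟩ _)
∉⟨⟩⇒∉ x∉ (Any.there x∈)  = x∉ (∈⇒∈⟨⟩ x∈)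

independent⇒distinctNonzero : ∀ {n} (xs : Vec 𝔽₂^ω n) → Independent xs → DistinctNonzero xs
independent⇒distinctNonzero []       _        = tt
independent⇒distinctNonzero (x ∷ xs) (x∉ , I) = ∉⟨⟩⇒∉ x∉ , independent⇒distinctNonzero xs I

-- Singles out an entry while the others keep their order. The two lengths are separate indices;
-- `insert-length` relates them where an induction hypothesis for a given length is used.
data Insert (z : 𝔽₂^ω) : ∀ {m n} → Vec 𝔽₂^ω m → Vec 𝔽₂^ω n → Set where
  here  : ∀ {n} {xs : Vec 𝔽₂^ω n} → Insert z xs (z ∷ xs)
  there : ∀ {m n y} {ys : Vec 𝔽₂^ω m} {xs : Vec 𝔽₂^ω n} →
          Insert z ys xs → Insert z (y ∷ ys) (y ∷ xs)

module _ {z : 𝔽₂^ω} where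

  insert-length : ∀ {m n} {ys : Vec 𝔽₂^ω m} {xs : Vec 𝔽₂^ω n} → Insert z ys xs → n ≡ suc m
  insert-length here      = refl
  insert-length (there i) = cong suc (insert-length i)

  insert-map : ∀ f {m n} {ys : Vec 𝔽₂^ω m} {xs : Vec 𝔽₂^ω n} →
               Insert z ys xs → Insert (f z) (map f ys) (map f xs)
  insert-map f here      = here
  insert-map f (there i) = there (insert-map f i)

  insert-∈ : ∀ {m n x} {ys : Vec 𝔽₂^ω m} {xs : Vec 𝔽₂^ω n} → Insert z ys xs → x ∈ ys → x ∈ xs
  insert-∈ here      x∈              = Any.there x∈
  insert-∈ (there i) (Any.here refl) = Any.here refl
  insert-∈ (there i) (Any.there x∈)  = Any.there (insert-∈ i x∈)

  exchange-head : ∀ x y v → x ⊕ (y ⊕ v) ≡ y ⊕ (x ⊕ v)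
  exchange-head x y v = solve (# 0F ⊞ (# 1F ⊞ # 2F))
    (# 1F ⊞ (# 0F ⊞ # 2F)) (x ∷ y ∷ v ∷ []) refl

  insert-span : ∀ {m n x} {ys : Vec 𝔽₂^ω m} {xs : Vec 𝔽₂^ω n} → Insert z ys xs →
                x ∈⟨ xs ⟩ → x ∈⟨ z ∷ ys ⟩
  insert-span here x∈ = x∈
  insert-span (there {y = y} {ys} i) (c ∷ k , refl) with insert-span i (k , refl)
  ... | d ∷ l , p = d ∷ c ∷ l ,
    trans (exchange-head (d · z) (c · y) (lincomb l ys)) (cong (c · y ⊕_) p)

  insert-span⁻ : ∀ {m n x} {ys : Vec 𝔽₂^ω m} {xs : Vec 𝔽₂^ω n} → Insert z ys xs →
                 x ∈⟨ z ∷ ys ⟩ → x ∈⟨ xs ⟩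
  insert-span⁻ here x∈ = x∈
  insert-span⁻ (there {y = y} {ys} i) (d ∷ c ∷ l , refl) with insert-span⁻ i (d ∷ l , refl)
  ... | k , p = c ∷ k ,
    trans (cong (c · y ⊕_) p) (exchange-head (c · y) (d · z) (lincomb l ys))

  -- The coefficient of z must be 1, as otherwise x would lie in the span of xs; adding the
  -- remaining terms to x then gives z.
  steinitz : ∀ {n x} {xs : Vec 𝔽₂^ω n} → x ∉⟨ xs ⟩ → x ∈⟨ z ∷ xs ⟩ → z ∈⟨ x ∷ xs ⟩
  steinitz x∉ (false ∷ k , p) = ⊥-elim (x∉ (k , p))
  steinitz {xs = xs} x∉ (true ∷ k , refl) = true ∷ k ,
    solve ((# 0F ⊞ # 1F) ⊞ # 1F) (# 0F) (z ∷ lincomb k xs ∷ []) refl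

  -- `Independent` is defined along the order of the entries. This lemma and its converse let one
  -- entry change its place, by exchange.
  insert-independent : ∀ {m n} {ys : Vec 𝔽₂^ω m} {xs : Vec 𝔽₂^ω n} → Insert z ys xs →
                       Independent (z ∷ ys) → Independent xs
  insert-independent here      I               = I
  insert-independent (there i) (z∉ , (y∉ , I)) =
    (λ y∈ → z∉ (steinitz y∉ (insert-span i y∈))) ,
    insert-independent i ((λ { (k , p) → z∉ (false ∷ k , p) }) , I)

  insert-independent⁻ : ∀ {m n} {ys : Vec 𝔽₂^ω m} {xs : Vec 𝔽₂^ω n} → Insert z ys xs →
                        Independent xs → Independent (z ∷ ys)
  insert-independent⁻ here      I        = I
  insert-independent⁻ (there i) (y∉ , I) with insert-independent⁻ i I
  ... | z∉ , J =
    (λ { (false ∷ k , p) → z∉ (k , p)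
       ; (true ∷ k , refl) → y∉ (insert-span⁻ i (true ∷ k ,
           solve ((# 0F ⊞ # 1F) ⊞ # 1F) (# 0F) (_ ∷ lincomb k _ ∷ []) refl)) }) ,
    (λ { (k , p) → y∉ (insert-span⁻ i (false ∷ k , p)) }) , J

-- Either all coefficients are 1, or some entry has coefficient 0 and can be left out. These are the
-- two dependent cases of `straighten`.
total-or-proper : ∀ {n} (k : Vec Bool n) xs →
  lincomb k xs ≡ total xs ⊎
  ∃[ m ] ∃[ z ] ∃[ ys ] Insert z {m} ys xs × lincomb k xs ∈⟨ ys ⟩
total-or-proper []          []       = inj₁ refl
total-or-proper (false ∷ k) (x ∷ xs) = inj₂ (_ , x , xs , here , k , refl)
total-or-proper (true ∷ k)  (x ∷ xs) with total-or-proper k xs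
... | inj₁ p                         = inj₁ (cong (x ⊕_) p)
... | inj₂ (m , z , ys , i , l , p)  =
  inj₂ (suc m , z , x ∷ ys , there i , true ∷ l , cong (x ⊕_) p)

map-≡⇒∈ : ∀ {A : Set} {f g : A → A} {n} {v : Vec A n} → map f v ≡ map g v →
          ∀ {x} → x ∈ v → f x ≡ g x
map-≡⇒∈ {v = y ∷ v} p (Any.here refl) = ∷-injectiveˡ p
map-≡⇒∈ {v = y ∷ v} p (Any.there x∈) = map-≡⇒∈ (∷-injectiveʳ p) x∈

∈⇒map-≡ : ∀ {A : Set} {f g : A → A} {n} (v : Vec A n) → (∀ {x} → x ∈ v → f x ≡ g x) →
          map f v ≡ map g v
∈⇒map-≡ []      h = refl
∈⇒map-≡ (x ∷ v) h = cong₂ _∷_ (h (Any.here refl)) (∈⇒map-≡ v (h ∘ Any.there))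

∈-map⁻ : ∀ (f : Permutation 𝔽₂^ω) {n x} {xs : Vec 𝔽₂^ω n} → to f x ∈ map (to f) xs → x ∈ xs
∈-map⁻ f {xs = y ∷ xs} (Any.here p)  = Any.here (to-injective f p)
∈-map⁻ f {xs = y ∷ xs} (Any.there p) = Any.there (∈-map⁻ f p)

-- As s = p + q, every combination of the three is one of 0, p, q, s.
two-of-three : ∀ {p q r s} → s ≡ p ⊕ q → r ∈⟨ p ∷ q ∷ s ∷ [] ⟩ →
               r ≢ p → r ≢ q → r ≢ s → r ≡ 𝟎
two-of-three {p} {q} refl (k , eq) r≢p r≢q r≢s = cases k eq
  where
  ρ : Vec 𝔽₂^ω 2
  ρ = p ∷ q ∷ []

  s : Expr 2
  s = # 0F ⊞ # 1F

  cases : ∀ k → lincomb k (p ∷ q ∷ (p ⊕ q) ∷ []) ≡ _ → _ ≡ 𝟎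
  cases (false ∷ false ∷ false ∷ []) eq = sym eq
  cases (true  ∷ false ∷ false ∷ []) eq =
    ⊥-elim (r≢p (trans (sym eq) (solve (# 0F ⊞ 𝕠) (# 0F) ρ refl)))
  cases (false ∷ true  ∷ false ∷ []) eq =
    ⊥-elim (r≢q (trans (sym eq) (solve (# 1F ⊞ 𝕠) (# 1F) ρ refl)))
  cases (true  ∷ true  ∷ false ∷ []) eq =
    ⊥-elim (r≢s (trans (sym eq) (solve (# 0F ⊞ (# 1F ⊞ 𝕠)) s ρ refl)))
  cases (false ∷ false ∷ true  ∷ []) eq =
    ⊥-elim (r≢s (trans (sym eq) (solve (s ⊞ 𝕠) s ρ refl)))
  cases (true  ∷ false ∷ true  ∷ []) eq =
    ⊥-elim (r≢q (trans (sym eq) (solve (# 0F ⊞ (s ⊞ 𝕠)) (# 1F) ρ refl)))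
  cases (false ∷ true  ∷ true  ∷ []) eq =
    ⊥-elim (r≢p (trans (sym eq) (solve (# 1F ⊞ (s ⊞ 𝕠)) (# 0F) ρ refl)))
  cases (true  ∷ true  ∷ true  ∷ []) eq = trans (sym eq) (solve (# 0F ⊞ (# 1F ⊞ (s ⊞ 𝕠))) 𝕠 ρ refl)

-- One of the four vectors may be 0, so the number of terms in s decides. With one term, s would
-- equal another vector. With two, say s = p + q, the third vector r is in the span of p, q, s but
-- is none of them, so r = 0. With none, s = 0 and r can only be p + q.
mutually-spanned⇒sum : ∀ {p q r s} → p ≢ q → p ≢ r → q ≢ r → p ≢ s → q ≢ s → r ≢ s →
  p ∈⟨ q ∷ r ∷ s ∷ [] ⟩ → q ∈⟨ p ∷ r ∷ s ∷ [] ⟩ → r ∈⟨ p ∷ q ∷ s ∷ [] ⟩ → s ∈⟨ p ∷ q ∷ r ∷ [] ⟩ →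
  s ≡ p ⊕ (q ⊕ r)
mutually-spanned⇒sum {p} {q} {r} {s} p≢q p≢r q≢r p≢s q≢s r≢s p∈ q∈ r∈ (k , eq) = cases k eq
  where
  third : ∀ k → s ≡ 𝟎 → lincomb k (p ∷ q ∷ []) ≡ r → r ≡ p ⊕ q
  third (false ∷ false ∷ []) s≡𝟎 eq = ⊥-elim (r≢s (trans (sym eq) (sym s≡𝟎)))
  third (true  ∷ false ∷ []) s≡𝟎 eq = ⊥-elim (p≢r (trans (sym (⊕-identityʳ p)) eq))
  third (false ∷ true  ∷ []) s≡𝟎 eq = ⊥-elim (q≢r (trans (sym (⊕-identityʳ q)) eq))
  third (true  ∷ true  ∷ []) s≡𝟎 eq = trans (sym eq) (cong (p ⊕_) (⊕-identityʳ q))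

  drop-s : s ≡ 𝟎 → r ∈⟨ p ∷ q ∷ s ∷ [] ⟩ → r ∈⟨ p ∷ q ∷ [] ⟩
  drop-s s≡𝟎 (c ∷ d ∷ e ∷ [] , eq) = c ∷ d ∷ [] , trans (cong (λ z → c · p ⊕ (d · q ⊕ z))
    (sym (trans (⊕-identityʳ (e · s)) (trans (cong (e ·_) s≡𝟎) (·-zeroʳ e))))) eq

  cases : ∀ k → lincomb k (p ∷ q ∷ r ∷ []) ≡ s → s ≡ p ⊕ (q ⊕ r)
  cases (false ∷ false ∷ false ∷ []) eq with drop-s (sym eq) r∈
  ... | l , eq′ with third l (sym eq) eq′
  ...   | refl = trans (sym eq) (solve 𝕠 (# 0F ⊞ (# 1F ⊞ (# 0F ⊞ # 1F))) (p ∷ q ∷ []) refl)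
  cases (true  ∷ false ∷ false ∷ []) eq = ⊥-elim (p≢s (trans (sym (⊕-identityʳ p)) eq))
  cases (false ∷ true  ∷ false ∷ []) eq = ⊥-elim (q≢s (trans (sym (⊕-identityʳ q)) eq))
  cases (false ∷ false ∷ true  ∷ []) eq =
    ⊥-elim (r≢s (trans (sym (⊕-identityʳ r)) eq))
  cases (true  ∷ true  ∷ false ∷ []) eq = trans (sym eq) (cong (λ z → p ⊕ (q ⊕ z))
    (sym (two-of-three (trans (sym eq) (cong (p ⊕_) (⊕-identityʳ q)))
      r∈ (p≢r ∘ sym) (q≢r ∘ sym) r≢s)))
  cases (true  ∷ false ∷ true  ∷ []) eq = trans (sym eq) (cong (p ⊕_)
    (trans (⊕-identityʳ r) (cong (_⊕ r)
      (sym (two-of-three (trans (sym eq) (cong (p ⊕_) (⊕-identityʳ r)))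
        q∈ (p≢q ∘ sym) q≢r q≢s)))))
  cases (false ∷ true  ∷ true  ∷ []) eq = trans (sym s≡q⊕r) (cong (_⊕ (q ⊕ r))
    (sym (two-of-three (sym s≡q⊕r) p∈ p≢q p≢r p≢s)))
    where s≡q⊕r = trans (cong (q ⊕_) (sym (⊕-identityʳ r))) eq
  cases (true  ∷ true  ∷ true  ∷ []) eq =
    trans (sym eq) (cong (λ z → p ⊕ (q ⊕ z)) (⊕-identityʳ r))

-- Affine permutations

affine⇒Aut : ∀ f → (∀ x y → to f (x ⊕ y) ≡ to f 𝟎 ⊕ (to f x ⊕ to f y)) → Aut affineSpace f
affine⇒Aut f affine ∙ (a ∷ b ∷ c ∷ d ∷ []) = mk⇔
  (λ p → trans (sym ternary) (cong (to f) p))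
  (λ p → to-injective f (trans ternary p))
  where
  ternary : to f ((a ⊕ b) ⊕ c) ≡ (to f a ⊕ to f b) ⊕ to f c
  ternary = trans (affine (a ⊕ b) c)
    (trans (cong (λ z → to f 𝟎 ⊕ (z ⊕ to f c)) (affine a b))
      (solve (# 0F ⊞ ((# 0F ⊞ (# 1F ⊞ # 2F)) ⊞ # 3F)) ((# 1F ⊞ # 2F) ⊞ # 3F)
        (to f 𝟎 ∷ to f a ∷ to f b ∷ to f c ∷ []) refl))

Aut-affine-⊕ : ∀ f → Aut affineSpace f → ∀ x y → to f (x ⊕ y) ≡ (to f x ⊕ to f y) ⊕ to f 𝟎
Aut-affine-⊕ f F x y =
  sym (Equivalence.to (F ∙ (x ∷ y ∷ 𝟎 ∷ (x ⊕ y) ∷ [])) (⊕-identityʳ (x ⊕ y)))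

Aut-affine-𝟎⇒linear : ∀ f → Aut affineSpace f → to f 𝟎 ≡ 𝟎 → Linear f
Aut-affine-𝟎⇒linear f F f𝟎 = additive⇒linear {f} λ x y → trans (Aut-affine-⊕ f F x y)
  (trans (cong (to f x ⊕ to f y ⊕_) f𝟎) (⊕-identityʳ _))

-- Homogeneity of the linear group

module LinearGroup (em : ExcludedMiddle 0ℓ) where

  open ReductOfVectorSpace em vectorSpace vectorSpace-reduct

  abstract

    -- No basis is extended here: the vector space is a reduct of itself, so tuples with the same
    -- dependences have the same type and lie in one orbit.
    linear-move : ∀ {n} {xs ys : Vec 𝔽₂^ω n} → xs ≃ ys → ∃[ f ] Linear f × map (to f) xs ≡ ys
    linear-move {xs = xs} {ys} s = homogeneous {ρ = xs} {ys} (≃⇒≼ s)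

  linear-displace : ∀ {n z} {us : Vec 𝔽₂^ω n} → z ∉⟨ us ⟩ →
    ∃[ f ] Linear f × map (to f) us ≡ us × to f z ≢ z
  linear-displace {z = z} {us} z∉ with avoid (z ∷ span us)
  ... | w , w∉ with linear-move (≃-independent ≃-refl z∉ (∉span⇒∉⟨⟩ (w∉ ∘ there)))
  ...   | f , F , eq = f , F , ∷-injectiveʳ eq ,
    λ p → w∉ (here (trans (sym (∷-injectiveˡ eq)) p))

  -- Translates statements on pointwise stabilizers into statements on spans: a vector outside the
  -- span could be sent to a different one outside it with us fixed.
  fixed⇒∈⟨⟩ : ∀ {n z} (us : Vec 𝔽₂^ω n) →
    (∀ f → Linear f → map (to f) us ≡ us → to f z ≡ z) → z ∈⟨ us ⟩
  fixed⇒∈⟨⟩ us fixed = decidable-stable em λ z∉ →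
    let (f , F , eq , moves) = linear-displace z∉ in moves (fixed f F eq)

-- Closed groups that contain the linear permutations

module Supergroup
  (em : ExcludedMiddle 0ℓ) (G : Pred (Permutation 𝔽₂^ω) 0ℓ)
  (G-∘ : ∀ {f g} → G f → G g → G (f ↔-∘ g)) (G-sym : ∀ {f} → G f → G (↔-sym f))
  -- Closedness under pointwise convergence. It also makes membership depend on the values only, see
  -- `G-resp`.
  (G-closed : ∀ f → (∀ {n} (v : Vec 𝔽₂^ω n) → ∃[ g ] G g × map (to g) v ≡ map (to f) v) → G f)
  (linear⊆G : ∀ {f} → Linear f → G f)
  where

  open LinearGroup em

  G-resp : ∀ {f g} → G f → (∀ x → to f x ≡ to g x) → G g
  G-resp {f} {g} F eq = G-closed g λ v → f , F , map-cong eq v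

  Moves𝟎 : Set
  Moves𝟎 = ∃[ f ] G f × to f 𝟎 ≢ 𝟎

  -- The nonzero vectors form one orbit of the linear permutations, so a single f moving 0 joins 0
  -- to them.
  transitive : Moves𝟎 → ∀ v → ∃[ f ] G f × to f 𝟎 ≡ v
  transitive (f , F , f𝟎≢𝟎) v with em {v ≡ 𝟎}
  ... | yes refl = ↔-sym f ↔-∘ f , G-∘ {↔-sym f} {f} (G-sym {f} F) F , from-to f 𝟎
  ... | no v≢𝟎
    with linear-move (independent-≃ (to f 𝟎 ∷ []) (v ∷ [])
                        (≢𝟎⇒independent f𝟎≢𝟎) (≢𝟎⇒independent v≢𝟎))
  ...   | h , H , eq = h ↔-∘ f , G-∘ {h} {f} (linear⊆G {h} H) F , ∷-injectiveˡ eq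

  Stabilizer : Pred (Permutation 𝔽₂^ω) 0ℓ
  Stabilizer f = G f × to f 𝟎 ≡ 𝟎

  S-∘ : ∀ {f g} → Stabilizer f → Stabilizer g → Stabilizer (f ↔-∘ g)
  S-∘ {f} {g} (F , f𝟎) (H , g𝟎) = G-∘ {f} {g} F H , trans (cong (to f) g𝟎) f𝟎

  S-sym : ∀ {f} → Stabilizer f → Stabilizer (↔-sym f)
  S-sym {f} (F , f𝟎) = G-sym {f} F , to-≡⇒from f f𝟎

  linear⊆S : ∀ {f} → Linear f → Stabilizer f
  linear⊆S {f} F = linear⊆G {f} F , linear-𝟎 {f} F

  S-∉ : ∀ {f} → Stabilizer f → ∀ {n x} {xs : Vec 𝔽₂^ω n} →
        x ∉ (𝟎 ∷ xs) → to f x ∉ (𝟎 ∷ map (to f) xs)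
  S-∉ {f} (F , f𝟎) {xs = xs} x∉ fx∈ = x∉ (∈-map⁻ f
    (subst (λ o → to f _ ∈ (o ∷ map (to f) xs)) (sym f𝟎) fx∈))

  -- The case of a nonlinear stabilizer of 0

  module Nonlinear (f : Permutation 𝔽₂^ω) (F : Stabilizer f) (x y : 𝔽₂^ω)
                   (nonadditive : to f (x ⊕ y) ≢ to f x ⊕ to f y) where

    private
      f𝟎 : to f 𝟎 ≡ 𝟎
      f𝟎 = proj₂ F

      f≢𝟎 : ∀ {z} → z ≢ 𝟎 → to f z ≢ 𝟎
      f≢𝟎 z≢𝟎 p = z≢𝟎 (to-injective f (trans p (sym f𝟎)))

      x≢𝟎 : x ≢ 𝟎
      x≢𝟎 refl = nonadditive (cong (_⊕ to f y) (sym f𝟎))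

      y≢𝟎 : y ≢ 𝟎
      y≢𝟎 refl = nonadditive (trans (cong (to f) (⊕-identityʳ x))
        (trans (sym (⊕-identityʳ (to f x))) (cong (to f x ⊕_) (sym f𝟎))))

      x≢y : x ≢ y
      x≢y refl = nonadditive (trans (cong (to f) (⊕-self x)) (trans f𝟎 (sym (⊕-self (to f x)))))

      s t : 𝔽₂^ω
      -- f takes s to the value that additivity would give at x + y, so s differs from x + y, which
      -- makes t nonzero.
      s = from f (to f x ⊕ to f y)
      t = s ⊕ (x ⊕ y)

      fs : to f s ≡ to f x ⊕ to f y
      fs = to-from f _

      s≢𝟎 : s ≢ 𝟎
      s≢𝟎 p = x≢y (to-injective f (⊕≡𝟎⇒≡ (trans (sym fs) (trans (cong (to f) p) f𝟎))))

      t≢𝟎 : t ≢ 𝟎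
      t≢𝟎 p = nonadditive (trans (cong (to f) (sym (⊕≡𝟎⇒≡ p))) fs)

      s⊕t : s ⊕ t ≡ x ⊕ y
      s⊕t = trans (sym (⊕-assoc s s (x ⊕ y))) (cong (_⊕ (x ⊕ y)) (⊕-self s))

      s≢t : s ≢ t
      s≢t p = x≢y (⊕≡𝟎⇒≡ (trans (sym s⊕t) (≡⇒⊕≡𝟎 p)))

      f-independent : ∀ {a b} → a ≢ 𝟎 → b ≢ 𝟎 → a ≢ b → Independent (to f a ∷ to f b ∷ [])
      f-independent a≢𝟎 b≢𝟎 a≢b =
        ≢⇒independent (f≢𝟎 a≢𝟎) (f≢𝟎 b≢𝟎) (a≢b ∘ to-injective f)

    -- f breaks the circuit x, y, s, t because f s = f x + f y and f t ≠ 0; padding it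
    -- with vectors c in general position on both sides gives two tuples with the
    -- same sum, for at least one of which f does not preserve the sum.
    two-sums : ∀ m → ∃[ us ] ∃[ vs ]
      (Independent {suc (suc m)} us × Independent (map (to f) us)) ×
      (Independent {suc (suc m)} vs × Independent (map (to f) vs)) ×
      total us ≡ total vs × total (map (to f) us) ≢ total (map (to f) vs)
    two-sums zero = x ∷ y ∷ [] , s ∷ t ∷ [] ,
      (≢⇒independent x≢𝟎 y≢𝟎 x≢y , f-independent x≢𝟎 y≢𝟎 x≢y) ,
      (≢⇒independent s≢𝟎 t≢𝟎 s≢t , f-independent s≢𝟎 t≢𝟎 s≢t) ,
      trans (cong (x ⊕_) (⊕-identityʳ y)) (trans (sym s⊕t) (cong (s ⊕_) (sym (⊕-identityʳ t)))) ,
      λ p → f≢𝟎 t≢𝟎 (solve-from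
        (# 0F ⊞ (# 1F ⊞ 𝕠)) ((# 0F ⊞ # 1F) ⊞ (# 2F ⊞ 𝕠))
        (# 2F) 𝕠 (to f x ∷ to f y ∷ to f t ∷ []) refl
        (trans p (cong (_⊕ (to f t ⊕ 𝟎)) fs)))
    two-sums (suc m) with two-sums m
    ... | us , vs , (I , fI) , (J , fJ) , eq , neq
      with avoid ((span us ++ span vs) ++
             (mapˡ (from f) (span (map (to f) us)) ++ mapˡ (from f) (span (map (to f) vs))))
    ... | c , c∉ = c ∷ us , c ∷ vs ,
      ((∉span⇒∉⟨⟩ (c∉ ∘ ∈-++⁺ˡ ∘ ∈-++⁺ˡ) , I) ,
       (∉span⇒∉⟨⟩ (c∉ ∘ ∈-++⁺ʳ (span us ++ span vs) ∘ ∈-++⁺ˡ ∘ image∈) , fI)) ,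
      ((∉span⇒∉⟨⟩ (c∉ ∘ ∈-++⁺ˡ ∘ ∈-++⁺ʳ (span us)) , J) ,
       (∉span⇒∉⟨⟩ (c∉ ∘ ∈-++⁺ʳ (span us ++ span vs) ∘
                    ∈-++⁺ʳ (mapˡ (from f) (span (map (to f) us))) ∘ image∈) , fJ)) ,
      cong (c ⊕_) eq ,
      λ p → neq (⊕-cancelˡ (to f c) p)
      where
      image∈ : ∀ {zs} → to f c ∈ˡ zs → c ∈ˡ mapˡ (from f) zs
      image∈ {zs} fc∈ = subst (_∈ˡ mapˡ (from f) zs) (from-to f c) (∈-map⁺ (from f) fc∈)

      ⊕-cancelˡ : ∀ a {u v} → a ⊕ u ≡ a ⊕ v → u ≡ v
      ⊕-cancelˡ a {u} {v} = solve-from (# 0F ⊞ # 1F) (# 0F ⊞ # 2F)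
        (# 1F) (# 2F) (a ∷ u ∷ v ∷ []) refl

    broken-circuit : ∀ m → ∃[ us ]
      Independent {suc (suc m)} us × Independent (map (to f) us) ×
      to f (total us) ≢ total (map (to f) us)
    broken-circuit m with two-sums m
    ... | us , vs , (I , fI) , (J , fJ) , eq , neq
      with em {to f (total us) ≡ total (map (to f) us)}
    ...   | no ¬p = us , I , fI , ¬p
    ...   | yes p = vs , J , fJ , λ q → neq (trans (sym p) (trans (cong (to f) eq) q))

    Straightenable : ∀ {n} → Vec 𝔽₂^ω n → Set
    Straightenable xs = ∃[ g ] Stabilizer g × Independent (map (to g) xs)

    straighten-∘ : ∀ {n} {h} (xs : Vec 𝔽₂^ω n) → Stabilizer h → Straightenable (map (to h) xs) →
                   Straightenable xs
    straighten-∘ {h = h} xs H (g , Γ , I) =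
      g ↔-∘ h , S-∘ {g} {h} Γ H , subst Independent (sym (map-∘ (to g) (to h) xs)) I

    straightenable : ∀ {n} {xs : Vec 𝔽₂^ω n} → Independent xs → Straightenable xs
    straightenable {xs = xs} I with linear-move (≃-refl {xs = xs})
    ... | h , H , eq = h , linear⊆S {h} H , subst Independent (sym eq) I

    -- Straightening x ∷ ys by g leaves infinitely many w outside the span of ys for which g w
    -- is in general position, and a linear map fixing ys, hence x, can take z to such a w.
    straighten-proper : ∀ {m x z} {ys : Vec 𝔽₂^ω m} {xs : Vec 𝔽₂^ω (suc m)} →
      (∀ (zs : Vec 𝔽₂^ω (suc m)) → DistinctNonzero zs → Straightenable zs) →
      Insert z ys xs → Independent xs → x ∈⟨ ys ⟩ → x ∉ (𝟎 ∷ xs) → Straightenable (x ∷ xs)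
    straighten-proper {x = x} {z} {ys} {xs} IH i I (k , refl) x∉
      with insert-independent⁻ i I
    -- With x in the place of z the tuple keeps its length, so the induction hypothesis reaches it.
    ... | z∉ , J with IH (x ∷ ys) ((λ
            { (Any.here p)  → x∉ (Any.here p)
            ; (Any.there p) → x∉ (Any.there (insert-∈ i p)) }) , independent⇒distinctNonzero ys J)
    ... | g , Γ , K with avoid (span ys ++ mapˡ (from g) (span (map (to g) (x ∷ ys))))
    ... | w , w∉ with linear-move (≃-independent {xs = ys} ≃-refl z∉ (∉span⇒∉⟨⟩ (w∉ ∘ ∈-++⁺ˡ)))
    ... | h , H , eq = g ↔-∘ h , S-∘ {g} {h} Γ (linear⊆S {h} H) ,
      insert-independent (insert-map (to (g ↔-∘ h)) (there i))
        (subst Independent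
          (trans (cong (map (to g)) (sym moved)) (sym (map-∘ (to g) (to h) (z ∷ x ∷ ys))))
          ((∉span⇒∉⟨⟩ λ p →
              w∉ (∈-++⁺ʳ (span ys) (subst (_∈ˡ _) (from-to g w) (∈-map⁺ (from g) p)))) , K))
      where
      moved : map (to h) (z ∷ x ∷ ys) ≡ w ∷ x ∷ ys
      moved = cong₂ (λ a us → a ∷ us) (∷-injectiveˡ eq)
        (cong₂ _∷_ (trans (linear-lincomb {h} H k ys) (cong (lincomb k) (∷-injectiveʳ eq)))
          (∷-injectiveʳ eq))

    -- For fewer than two entries the sum is 0 or the entry itself, which is excluded. Otherwise a
    -- linear map takes xs to a tuple us at which f breaks the circuit of this length. After f the
    -- image of the sum is no longer the sum of the images, so it is outside their span or a sum
    -- that leaves some of them out.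
    straighten-circuit : ∀ {n} → (∀ (zs : Vec 𝔽₂^ω n) → DistinctNonzero zs → Straightenable zs) →
      ∀ (xs : Vec 𝔽₂^ω n) → Independent xs → total xs ∉ (𝟎 ∷ xs) → Straightenable (total xs ∷ xs)
    straighten-circuit IH []       I x∉ = ⊥-elim (x∉ (Any.here refl))
    straighten-circuit IH (y ∷ []) I x∉ = ⊥-elim (x∉ (Any.there (Any.here (⊕-identityʳ y))))
    straighten-circuit {suc (suc m)} IH xs@(_ ∷ _ ∷ _) I x∉ with broken-circuit m
    ... | us , J , fJ , broken with linear-move (independent-≃ xs us I J)
    ... | h , H , refl = straighten-∘ {h = h} (total xs ∷ xs) (linear⊆S {h} H)
      (straighten-∘ {h = f} (to h (total xs) ∷ us) F image)
      where
      h-total : to h (total xs) ≡ total us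
      h-total = linear-lincomb {h} H (replicate _ true) xs

      image : Straightenable (to f (to h (total xs)) ∷ map (to f) us)
      image with em {to f (to h (total xs)) ∈⟨ map (to f) us ⟩}
      ... | no x∉′ = straightenable (x∉′ , fJ)
      ... | yes (k , p) with total-or-proper k (map (to f) us)
      ...   | inj₁ q = ⊥-elim (broken (trans (cong (to f) (sym h-total)) (trans (sym p) q)))
      ...   | inj₂ (m , z , ys , i , q) with insert-length i
      ...     | refl = straighten-proper IH i fJ (subst (_∈⟨ ys ⟩) p q)
        (S-∉ {f} F (S-∉ {h} (linear⊆S {h} H) x∉))

    -- Once the tail is independent, the image of x can be outside its span, the sum of all its
    -- entries, or a sum that omits one. The recursive calls are for the length of the tail.
    straighten : ∀ {n} (xs : Vec 𝔽₂^ω n) → DistinctNonzero xs → Straightenable xs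
    straighten []       _        = straightenable tt
    straighten (x ∷ xs) (x∉ , D) with straighten xs D
    ... | g , Γ , I = straighten-∘ {h = g} (x ∷ xs) Γ image
      where
      gx∉ : to g x ∉ (𝟎 ∷ map (to g) xs)
      gx∉ = S-∉ {g} Γ x∉

      image : Straightenable (to g x ∷ map (to g) xs)
      image with em {to g x ∈⟨ map (to g) xs ⟩}
      ... | no gx∉′ = straightenable (gx∉′ , I)
      ... | yes (k , p) with total-or-proper k (map (to g) xs)
      ...   | inj₁ q = subst (λ a → Straightenable (a ∷ map (to g) xs)) (trans (sym q) p)
        (straighten-circuit straighten (map (to g) xs) I
          (subst (_∉ (𝟎 ∷ map (to g) xs)) (trans (sym p) q) gx∉))
      ...   | inj₂ (m , z , ys , i , q) with insert-length i
      ...     | refl = straighten-proper straighten i I (subst (_∈⟨ ys ⟩) p q) gx∉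

    distinctNonzero-map : ∀ k → to k 𝟎 ≡ 𝟎 → ∀ {n} (xs : Vec 𝔽₂^ω n) →
      DistinctNonzero xs → DistinctNonzero (map (to k) xs)
    distinctNonzero-map k k𝟎 []       _        = tt
    distinctNonzero-map k k𝟎 (x ∷ xs) (x∉ , D) =
      (λ kx∈ → x∉ (∈-map⁻ k (subst (λ o → to k x ∈ (o ∷ map (to k) xs)) (sym k𝟎) kx∈))) ,
      distinctNonzero-map k k𝟎 xs D

    -- Strips v of zeros and repetitions, which no permutation fixing 0 could make independent.
    nonzero-support : ∀ {n} (v : Vec 𝔽₂^ω n) →
      ∃[ m ] ∃[ ws ] DistinctNonzero {m} ws × (∀ {x} → x ∈ v → x ∈ (𝟎 ∷ ws))
    nonzero-support []      = 0 , [] , tt , λ ()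
    nonzero-support (x ∷ v) with nonzero-support v
    ... | m , ws , D , cover with em {x ∈ (𝟎 ∷ ws)}
    ...   | yes x∈ = m , ws , D , λ { (Any.here refl) → x∈ ; (Any.there y∈) → cover y∈ }
    ...   | no x∉  = suc m , x ∷ ws , (x∉ , D) , λ
      { (Any.here refl) → Any.there (Any.here refl) ; (Any.there y∈) → skip (cover y∈) }
      where
      skip : ∀ {y} → y ∈ (𝟎 ∷ ws) → y ∈ (𝟎 ∷ x ∷ ws)
      skip (Any.here p)  = Any.here p
      skip (Any.there p) = Any.there (Any.there p)

    -- Straighten ws by g and its image under k by h. A linear l takes the first independent tuple
    -- to the second, so h⁻¹ l g agrees with k on ws and at 0.
    Sym₀⊆G : ∀ k → Sym₀ k → G k
    Sym₀⊆G k k𝟎 = G-closed k approximate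
      where
      approximate : ∀ {n} (v : Vec 𝔽₂^ω n) → ∃[ g ] G g × map (to g) v ≡ map (to k) v
      approximate v with nonzero-support v
      ... | m , ws , D , cover
        with straighten ws D | straighten (map (to k) ws) (distinctNonzero-map k k𝟎 ws D)
      ... | g , Γ , I | h , H , J
        with linear-move (independent-≃ (map (to g) ws) (map (to h) (map (to k) ws)) I J)
      ... | l , L , eq = h⁻¹lg , proj₁ stabilizes , ∈⇒map-≡ v (agree ∘ cover)
        where
        h⁻¹lg : Permutation 𝔽₂^ω
        h⁻¹lg = ↔-sym h ↔-∘ (l ↔-∘ g)

        stabilizes : Stabilizer h⁻¹lg
        stabilizes = S-∘ {↔-sym h} {l ↔-∘ g} (S-sym {h} H) (S-∘ {l} {g} (linear⊆S {l} L) Γ)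

        on-ws : map (to l ∘ to g) ws ≡ map (to h ∘ to k) ws
        on-ws = trans (map-∘ (to l) (to g) ws) (trans eq (sym (map-∘ (to h) (to k) ws)))

        agree : ∀ {x} → x ∈ (𝟎 ∷ ws) → to h⁻¹lg x ≡ to k x
        agree (Any.here refl) = trans (proj₂ stabilizes) (sym k𝟎)
        agree (Any.there x∈)  = to-≡⇒from h (sym (map-≡⇒∈ on-ws x∈))

    Sym⊆G : Moves𝟎 → ∀ k → G k
    Sym⊆G moves k with transitive moves (to k 𝟎)
    ... | g , Gg , eq = G-resp {g ↔-∘ (↔-sym g ↔-∘ k)} {k}
      (G-∘ {g} {↔-sym g ↔-∘ k} Gg (Sym₀⊆G (↔-sym g ↔-∘ k) (to-≡⇒from g eq)))
      (λ x → to-from g (to k x))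

  -- The case of a linear stabilizer of 0

  module AdditiveStabilizer (additive : ∀ f → Stabilizer f → Additive f) (moves : Moves𝟎) where

    stabilizer-fixes-sum : ∀ g → G g → ∀ {x y} → to g 𝟎 ≡ 𝟎 → to g x ≡ x → to g y ≡ y →
                           to g (x ⊕ y) ≡ x ⊕ y
    stabilizer-fixes-sum g Gg {x} {y} g𝟎 gx gy = trans (additive g (Gg , g𝟎) x y) (cong₂ _⊕_ gx gy)

    conjugate : Permutation 𝔽₂^ω → Permutation 𝔽₂^ω → Permutation 𝔽₂^ω
    conjugate f g = ↔-sym f ↔-∘ (g ↔-∘ f)

    G-conjugate : ∀ {f g} → G f → G g → G (conjugate f g)
    G-conjugate {f} {g} F Gg = G-∘ {↔-sym f} {g ↔-∘ f} (G-sym {f} F) (G-∘ {g} {f} Gg F)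

    conjugate-fixes⁻ : ∀ f g {x} → to (conjugate f g) x ≡ x → to g (to f x) ≡ to f x
    conjugate-fixes⁻ f g {x} p = trans (sym (to-from f _)) (cong (to f) p)

    -- With k ∈ G taking 0 to x, all of G fixing x, y and x + y also fixes d. Linear maps
    -- show that d is in the span of x and y, and then d = 0 since it is none of x, y, x + y.
    fixes-triple⇒fixes-𝟎 : ∀ {x y} → x ≢ 𝟎 → y ≢ 𝟎 → x ≢ y → ∀ g → G g →
      to g x ≡ x → to g y ≡ y → to g (x ⊕ y) ≡ x ⊕ y → to g 𝟎 ≡ 𝟎
    fixes-triple⇒fixes-𝟎 {x} {y} x≢𝟎 y≢𝟎 x≢y g Gg gx gy gxy with transitive moves x
    ... | k , K , k𝟎 = subst (λ z → to g z ≡ z) d≡𝟎 (fixes-d g Gg gx gy gxy)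
      where
      u v d : 𝔽₂^ω
      u = from k y
      v = from k (x ⊕ y)
      d = to k (u ⊕ v)

      fixes-d : ∀ g → G g → to g x ≡ x → to g y ≡ y → to g (x ⊕ y) ≡ x ⊕ y → to g d ≡ d
      fixes-d g Gg gx gy gxy = conjugate-fixes⁻ k g
        (stabilizer-fixes-sum (conjugate k g) (G-conjugate {k} {g} K Gg)
          (trans (cong (from k ∘ to g) k𝟎) (trans (cong (from k) gx) (to-≡⇒from k k𝟎)))
          (cong (from k) (trans (cong (to g) (to-from k y)) gy))
          (cong (from k) (trans (cong (to g) (to-from k (x ⊕ y))) gxy)))

      d∈ : d ∈⟨ x ∷ y ∷ (x ⊕ y) ∷ [] ⟩
      d∈ = fixed⇒∈⟨⟩ (x ∷ y ∷ (x ⊕ y) ∷ []) λ h H eq →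
        fixes-d h (linear⊆G {h} H) (∷-injectiveˡ eq) (∷-injectiveˡ (∷-injectiveʳ eq))
          (∷-injectiveˡ (∷-injectiveʳ (∷-injectiveʳ eq)))

      d≢x : d ≢ x
      d≢x p = x≢𝟎 (solve-from (# 1F) (# 0F ⊞ # 1F) (# 0F) 𝕠 (x ∷ y ∷ []) refl
        (to-injective (↔-sym k) (⊕≡𝟎⇒≡ (to-injective k (trans p (sym k𝟎))))))

      d≢y : d ≢ y
      d≢y p = y≢𝟎 (solve-from (# 0F ⊞ # 1F) (# 0F) (# 1F) 𝕠 (x ∷ y ∷ []) refl
        (trans (sym (to-from k (x ⊕ y))) (trans (cong (to k) v≡𝟎) k𝟎)))
        where
        v≡𝟎 : v ≡ 𝟎
        v≡𝟎 = solve-from (# 0F ⊞ # 1F) (# 0F) (# 1F) 𝕠 (u ∷ v ∷ []) refl (sym (to-≡⇒from k p))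

      d≢x⊕y : d ≢ x ⊕ y
      d≢x⊕y p = x≢y (trans (sym k𝟎) (trans (cong (to k) (sym u≡𝟎)) (to-from k y)))
        where
        u≡𝟎 : u ≡ 𝟎
        u≡𝟎 = solve-from (# 0F ⊞ # 1F) (# 1F) (# 0F) 𝕠 (u ∷ v ∷ []) refl (sym (to-≡⇒from k p))

      d≡𝟎 : d ≡ 𝟎
      d≡𝟎 = two-of-three refl d∈ d≢x d≢y d≢x⊕y

    affine-generic : ∀ f → G f → ∀ {x y} → x ≢ 𝟎 → y ≢ 𝟎 → x ≢ y →
                     to f (x ⊕ y) ≡ to f 𝟎 ⊕ (to f x ⊕ to f y)
    affine-generic f F {x} {y} x≢𝟎 y≢𝟎 x≢y = mutually-spanned⇒sum
      (x≢𝟎 ∘ sym ∘ to-injective f) (y≢𝟎 ∘ sym ∘ to-injective f) (x≢y ∘ to-injective f)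
      (λ p → x≢y (⊕≡𝟎⇒≡ (sym (to-injective f p))))
      (λ p → y≢𝟎 (solve-from (# 0F) (# 0F ⊞ # 1F) (# 1F) 𝕠 (x ∷ y ∷ []) refl (to-injective f p)))
      (λ p → x≢𝟎 (solve-from (# 1F) (# 0F ⊞ # 1F) (# 0F) 𝕠 (x ∷ y ∷ []) refl (to-injective f p)))
      (spanned λ g Gg gx gy gxy → fixes-triple⇒fixes-𝟎 x≢𝟎 y≢𝟎 x≢y g Gg gx gy gxy)
      (spanned λ g Gg g𝟎 gy gxy → subst (λ z → to g z ≡ z) y+sum
        (stabilizer-fixes-sum g Gg g𝟎 gy gxy))
      (spanned λ g Gg g𝟎 gx gxy → subst (λ z → to g z ≡ z) x+sum
        (stabilizer-fixes-sum g Gg g𝟎 gx gxy))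
      (spanned λ g Gg g𝟎 gx gy → stabilizer-fixes-sum g Gg g𝟎 gx gy)
      where
      y+sum : y ⊕ (x ⊕ y) ≡ x
      y+sum = solve (# 1F ⊞ (# 0F ⊞ # 1F)) (# 0F) (x ∷ y ∷ []) refl

      x+sum : x ⊕ (x ⊕ y) ≡ y
      x+sum = solve (# 0F ⊞ (# 0F ⊞ # 1F)) (# 1F) (x ∷ y ∷ []) refl

      -- If a linear h fixes the images of a, b, c under f, then f⁻¹ h f is in G and fixes a, b, c,
      -- hence d; so h fixes the image of d.
      spanned : ∀ {a b c d} →
        (∀ g → G g → to g a ≡ a → to g b ≡ b → to g c ≡ c → to g d ≡ d) →
        to f d ∈⟨ to f a ∷ to f b ∷ to f c ∷ [] ⟩
      spanned {a} {b} {c} {d} fixes = fixed⇒∈⟨⟩ (to f a ∷ to f b ∷ to f c ∷ []) λ h H eq →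
        conjugate-fixes⁻ f h (fixes (conjugate f h) (G-conjugate {f} {h} F (linear⊆G {h} H))
          (to-≡⇒from f (sym (∷-injectiveˡ eq)))
          (to-≡⇒from f (sym (∷-injectiveˡ (∷-injectiveʳ eq))))
          (to-≡⇒from f (sym (∷-injectiveˡ (∷-injectiveʳ (∷-injectiveʳ eq))))))

    affine-⊕ : ∀ f → G f → ∀ x y → to f (x ⊕ y) ≡ to f 𝟎 ⊕ (to f x ⊕ to f y)
    affine-⊕ f F x y with em {x ≡ 𝟎} | em {y ≡ 𝟎} | em {x ≡ y}
    ... | yes refl | _ | _ = solve (# 1F) (# 0F ⊞ (# 0F ⊞ # 1F)) (to f 𝟎 ∷ to f y ∷ []) refl
    ... | no _ | yes refl | _ = trans (cong (to f) (⊕-identityʳ x))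
      (solve (# 1F) (# 0F ⊞ (# 1F ⊞ # 0F)) (to f 𝟎 ∷ to f x ∷ []) refl)
    ... | no _ | no _ | yes refl = trans (cong (to f) (⊕-self x))
      (solve (# 0F) (# 0F ⊞ (# 1F ⊞ # 1F)) (to f 𝟎 ∷ to f x ∷ []) refl)
    ... | no x≢𝟎 | no y≢𝟎 | no x≢y = affine-generic f F x≢𝟎 y≢𝟎 x≢y

    G⊆affine : ∀ {f} → G f → Aut affineSpace f
    G⊆affine {f} F = affine⇒Aut f (affine-⊕ f F)

    -- Some f in G agrees with k at 0. As f is affine by the other inclusion, f⁻¹ k is affine and
    -- fixes 0, hence linear.
    affine⊆G : ∀ {k} → Aut affineSpace k → G k
    affine⊆G {k} K with transitive moves (to k 𝟎)
    ... | f , F , f𝟎 = G-resp {f ↔-∘ m} {k} (G-∘ {f} {m} F (linear⊆G {m} m-linear))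
      (λ x → to-from f (to k x))
      where
      m : Permutation 𝔽₂^ω
      m = ↔-sym f ↔-∘ k

      m-linear : Linear m
      m-linear = Aut-affine-𝟎⇒linear m
        (Aut-∘ affineSpace {↔-sym f} {k} (Aut-sym affineSpace {f} (G⊆affine {f} F)) K)
        (to-≡⇒from f f𝟎)

-- The four automorphism groups

Aut-closed : ∀ {A : Set} (N : Structure A) f →
  (∀ {n} (v : Vec A n) → ∃[ g ] Aut N g × map (to g) v ≡ map (to f) v) → Aut N f
Aut-closed N f approximate R v with approximate v
... | g , Gg , eq = mk⇔
  (subst (rel N R) eq ∘ Equivalence.to (Gg R v))
  (Equivalence.from (Gg R v) ∘ subst (rel N R) (sym eq))

Linear⊆GL : ∀ {f} → Linear f → GL f
Linear⊆GL {f} F = record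
  { +ᴹ-isGroupHomomorphism = record
    { isMonoidHomomorphism = record
      { isMagmaHomomorphism = record
        { isRelHomomorphism = record { cong = cong (to f) }
        ; homo = linear⇒additive {f} F }
      ; ε-homo = linear-𝟎 {f} F }
    ; ⁻¹-homo = λ _ → refl }
  ; *ₗ-homo = additive-· {f} (linear⇒additive {f} F) }

GL⊆Linear : ∀ {f} → GL f → Linear f
GL⊆Linear {f} F = additive⇒linear {f} (IsLeftModuleHomomorphism.+ᴹ-homo F)

Linear⊆Aut-affine : ∀ {f} → Linear f → Aut affineSpace f
Linear⊆Aut-affine {f} F = affine⇒Aut f λ x y →
  trans (linear⇒additive {f} F x y) (cong (_⊕ (to f x ⊕ to f y)) (sym (linear-𝟎 {f} F)))

translation : 𝔽₂^ω → Permutation 𝔽₂^ω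
translation a = mk↔ₛ′ (_⊕ a) (_⊕ a) involutive involutive
  where
  involutive : ∀ v → (v ⊕ a) ⊕ a ≡ v
  involutive v = solve ((# 0F ⊞ # 1F) ⊞ # 1F) (# 0F) (v ∷ a ∷ []) refl

Translation⊆Aut-affine : ∀ {f} → Translation f → Aut affineSpace f
Translation⊆Aut-affine {f} (a , eq) = affine⇒Aut f λ x y → trans (eq (x ⊕ y))
  (trans (solve ((# 1F ⊞ # 2F) ⊞ # 0F) (# 0F ⊞ ((# 1F ⊞ # 0F) ⊞ (# 2F ⊞ # 0F)))
            (a ∷ x ∷ y ∷ []) refl)
    (sym (cong₂ _⊕_ (eq 𝟎) (cong₂ _⊕_ (eq x) (eq y)))))

AGL⊆Aut-affine : ∀ {f} → AGL f → Aut affineSpace f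
AGL⊆Aut-affine (gen {f} (inj₁ F))   = Linear⊆Aut-affine {f} (GL⊆Linear {f} F)
AGL⊆Aut-affine (gen {f} (inj₂ F))   = Translation⊆Aut-affine {f} F
AGL⊆Aut-affine idn                  = Aut-closed affineSpace (↔-id _) λ v →
  translation 𝟎 , Translation⊆Aut-affine {translation 𝟎} (𝟎 , λ _ → refl) , map-cong ⊕-identityʳ v
AGL⊆Aut-affine (comp {f} {g} F G)   =
  Aut-∘ affineSpace {f} {g} (AGL⊆Aut-affine F) (AGL⊆Aut-affine G)
AGL⊆Aut-affine (inv {f} F)          = Aut-sym affineSpace {f} (AGL⊆Aut-affine F)
AGL⊆Aut-affine (resp {f} {g} eq F)  = Aut-closed affineSpace g λ v →
  f , AGL⊆Aut-affine F , map-cong eq v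

-- Translating by the image of 0 makes f linear; the same translation, being its own inverse,
-- restores f.
Aut-affine⊆AGL : ∀ {f} → Aut affineSpace f → AGL f
Aut-affine⊆AGL {f} F = resp {f = t ↔-∘ (t ↔-∘ f)} {f} (to-from t ∘ to f)
  (comp {f = t} {t ↔-∘ f} (gen (inj₂ (to f 𝟎 , λ _ → refl)))
    (gen (inj₁ (Linear⊆GL {t ↔-∘ f} t∘f-linear))))
  where
  t : Permutation 𝔽₂^ω
  t = translation (to f 𝟎)

  t∘f-linear : Linear (t ↔-∘ f)
  t∘f-linear = Aut-affine-𝟎⇒linear (t ↔-∘ f)
    (Aut-∘ affineSpace {t} {f} (Translation⊆Aut-affine {t} (to f 𝟎 , λ _ → refl)) F)
    (⊕-self (to f 𝟎))

Aut-pointed⊆Sym₀ : ∀ {f} → Aut pointedSet f → Sym₀ f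
Aut-pointed⊆Sym₀ F = Equivalence.to (F ∙ (𝟎 ∷ [])) refl

Sym₀⊆Aut-pointed : ∀ {f} → Sym₀ f → Aut pointedSet f
Sym₀⊆Aut-pointed {f} f𝟎 ∙ (x ∷ []) =
  mk⇔ (λ p → trans (cong (to f) p) f𝟎) (λ p → to-injective f (trans p (sym f𝟎)))

Linear⊆Aut-reduct : ∀ k {f} → Linear f → Aut (reduct k) f
Linear⊆Aut-reduct 0F F     = F
Linear⊆Aut-reduct 1F {f} F = Linear⊆Aut-affine {f} F
Linear⊆Aut-reduct 2F {f} F = Sym₀⊆Aut-pointed {f} (linear-𝟎 {f} F)
Linear⊆Aut-reduct 3F F ()

-- The reducts are told apart by which of two permutations are automorphisms: a translation,
-- and the transposition of the vectors 1, 0, 0, … and 1, 1, 0, 0, …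

e₀ e₂ : 𝔽₂^ω
e₀ = nz (e⁺ 0)
e₂ = nz (e⁺ 2)

transposition : Permutation 𝔽₂^ω
transposition = mk↔ₛ′ swap swap involutive involutive
  where
  swap : 𝔽₂^ω → 𝔽₂^ω
  swap (nz [1])          = nz (true ∷ [1])
  swap (nz (true ∷ [1])) = nz [1]
  swap v                 = v

  involutive : ∀ v → swap (swap v) ≡ v
  involutive 𝟎                       = refl
  involutive (nz [1])                = refl
  involutive (nz (true ∷ [1]))       = refl
  involutive (nz (true ∷ (_ ∷ _)))   = refl
  involutive (nz (false ∷ _))        = refl

translation-affine : Aut affineSpace (translation e₀)
translation-affine = Translation⊆Aut-affine {translation e₀} (e₀ , λ _ → refl)

translation? : ∀ k → Dec (Aut (reduct k) (translation e₀))
translation? 0F = no λ F → case linear-𝟎 {translation e₀} F of λ ()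
translation? 1F = yes translation-affine
translation? 2F = no λ F → case Aut-pointed⊆Sym₀ {translation e₀} F of λ ()
translation? 3F = yes λ ()

-- Of the four vectors, which sum to 0, the transposition moves only `e₀`. The unit vector with
-- index 1 would not do in place of `e₂`: its sum with `e₀` is the vector exchanged with `e₀`, and
-- the relation survives.
¬transposition-affine : ¬ Aut affineSpace transposition
¬transposition-affine F with Equivalence.to (F ∙ (e₀ ∷ e₂ ∷ 𝟎 ∷ (e₀ ⊕ e₂) ∷ [])) refl
... | ()

transposition? : ∀ k → Dec (Aut (reduct k) transposition)
transposition? 0F = no (¬transposition-affine ∘ Linear⊆Aut-affine {transposition})
transposition? 1F = no ¬transposition-affine
transposition? 2F = yes (Sym₀⊆Aut-pointed {transposition} refl)
transposition? 3F = yes λ ()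

interdefinable⇒≡ : ∀ j k → Interdefinable (reduct j) (reduct k) → j ≡ k
interdefinable⇒≡ j k (j-red , k-red) =
  separated j k (same (translation e₀) translation?) (same transposition transposition?)
  where
  same : ∀ f (f? : ∀ i → Dec (Aut (reduct i) f)) → does (f? j) ≡ does (f? k)
  same f f? = does-⇔ (mk⇔ (reduct⇒Aut⊆ (reduct j) (reduct k) k-red {f})
    (reduct⇒Aut⊆ (reduct k) (reduct j) j-red {f})) (f? j) (f? k)

  separated : ∀ j k → does (translation? j) ≡ does (translation? k) →
              does (transposition? j) ≡ does (transposition? k) → j ≡ k
  separated 0F 0F _  _  = refl
  separated 0F 1F () _
  separated 0F 2F _  ()
  separated 0F 3F () _
  separated 1F 0F () _
  separated 1F 1F _  _  = refl
  separated 1F 2F () _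
  separated 1F 3F _  ()
  separated 2F 0F _  ()
  separated 2F 1F () _
  separated 2F 2F _  _  = refl
  separated 2F 3F () _
  separated 3F 0F () _
  separated 3F 1F _  ()
  separated 3F 2F () _
  separated 3F 3F _  _  = refl

-- The classification of the reducts

module Classification (em : ExcludedMiddle 0ℓ) where

  -- Relations of N are invariant under the smaller group `Aut M`, hence definable in M, which has
  -- finitely many types as a reduct of the vector space.
  Aut⊆⇒reduct : ∀ M N → M IsReductOf vectorSpace → (∀ {f} → Aut M f → Aut N f) → N IsReductOf M
  Aut⊆⇒reduct M N red sub R =
    ReductOfVectorSpace.Aut-invariant⇒definable em M red {P = rel N R}
      (λ f F v → Equivalence.to (sub {f} F R v))

  reduct-of-vectorSpace : ∀ k → reduct k IsReductOf vectorSpace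
  reduct-of-vectorSpace k = Aut⊆⇒reduct vectorSpace (reduct k) vectorSpace-reduct
    (λ {f} → Linear⊆Aut-reduct k {f})

  -- Two questions separate the four groups: whether the stabilizer of 0 is additive, and whether 0
  -- is moved.
  Aut-classification : ∀ N → N IsReductOf vectorSpace →
    ∃[ k ] (∀ {f} → Aut N f → Aut (reduct k) f) × (∀ {f} → Aut (reduct k) f → Aut N f)
  Aut-classification N red = cases em em
    where
    open Supergroup em (Aut N) (λ {f} {g} → Aut-∘ N {f} {g}) (λ {f} → Aut-sym N {f})
      (Aut-closed N) (λ {f} → reduct⇒Aut⊆ vectorSpace N red {f})

    nonadditive-witness : ¬ (∀ f → Stabilizer f → Additive f) →
      ∃[ f ] Stabilizer f × ∃[ x ] ∃[ y ] to f (x ⊕ y) ≢ to f x ⊕ to f y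
    nonadditive-witness ¬additive = decidable-stable em λ none → ¬additive λ f F x y →
      decidable-stable em λ neq → none (f , F , x , y , neq)

    fixes-𝟎 : ¬ Moves𝟎 → ∀ {f} → Aut N f → to f 𝟎 ≡ 𝟎
    fixes-𝟎 ¬moves {f} F = decidable-stable em λ f𝟎≢𝟎 → ¬moves (f , F , f𝟎≢𝟎)

    cases : Dec (∀ f → Stabilizer f → Additive f) → Dec Moves𝟎 →
      ∃[ k ] (∀ {f} → Aut N f → Aut (reduct k) f) × (∀ {f} → Aut (reduct k) f → Aut N f)
    cases (yes additive) (no ¬moves) = 0F ,
      (λ {f} F → additive⇒linear {f} (additive f (F , fixes-𝟎 ¬moves {f} F))) ,
      (λ {f} → reduct⇒Aut⊆ vectorSpace N red {f})
    cases (yes additive) (yes moves) = 1F , (λ {f} → G⊆affine {f}) , (λ {f} → affine⊆G {f})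
      where open AdditiveStabilizer additive moves
    cases (no ¬additive) (no ¬moves) with nonadditive-witness ¬additive
    ... | g , G , x , y , neq = 2F , (λ {f} F → Sym₀⊆Aut-pointed {f} (fixes-𝟎 ¬moves {f} F)) ,
      (λ {f} F → Nonlinear.Sym₀⊆G g G x y neq f (Aut-pointed⊆Sym₀ {f} F))
    cases (no ¬additive) (yes moves) with nonadditive-witness ¬additive
    ... | g , G , x , y , neq = 3F , (λ _ ()) , (λ {f} _ → Nonlinear.Sym⊆G g G x y neq moves f)

  interdefinable-with-reduct : ∀ N → N IsReductOf vectorSpace → ∃[ k ] Interdefinable N (reduct k)
  interdefinable-with-reduct N red with Aut-classification N red
  ... | k , N⊆k , k⊆N = k ,
    Aut⊆⇒reduct (reduct k) N (reduct-of-vectorSpace k) (λ {f} → k⊆N {f}) ,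
    Aut⊆⇒reduct N (reduct k) red (λ {f} → N⊆k {f})

corollary3p1 : ExcludedMiddle 0ℓ →
    (∀ k → reduct k IsReductOf vectorSpace)
    × (∀ j k → Interdefinable (reduct j) (reduct k) → j ≡ k)
    × (∀ N → N IsReductOf vectorSpace → ∃[ k ] Interdefinable N (reduct k))
    × (Aut vectorSpace ≐ GL)
    × (Aut affineSpace ≐ AGL)
    × (Aut pointedSet ≐ Sym₀)
    × (Aut trivial ≐ Sym)
corollary3p1 em =
  Classification.reduct-of-vectorSpace em ,
  interdefinable⇒≡ ,
  Classification.interdefinable-with-reduct em ,
  ((λ {f} → Linear⊆GL {f}) , (λ {f} → GL⊆Linear {f})) ,
  ((λ {f} → Aut-affine⊆AGL {f}) , (λ {f} → AGL⊆Aut-affine {f})) ,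
  ((λ {f} → Aut-pointed⊆Sym₀ {f}) , (λ {f} → Sym₀⊆Aut-pointed {f})) ,
  ((λ _ → _) , (λ _ ()))
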